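{- There is a constant $c$ such that for every $d\ge1$ the parameterized problem $p\textsc{ - }d\textsc{ -Hitting-Set}$ is slicewise definable in $\mathrm{FO}_q$ for some $q\le c\cdot d^2$ (i.e., $p\textsc{ - }d\textsc{ -Hitting-Set}$ is slicewise definable in $\mathrm{FO}_q$ with $q=O(d^2)$).
   Context: A hypergraph $\mathbf G=(V,E)$ consists of a finite set $V$ of vertices and a set $E$ of nonempty subsets of $V$ (hyperedges). It is viewed as the $\{E_0,\epsilon\}$-structure with universe $V\cup E$, $E_0$ unary interpreted as $E$, and $\epsilon$ binary interpreted as $\{(v,e):v\in V, e\in E, v\in e\}$. A hitting set is a set $H\subseteq V$ with $H\cap e\neq\emptyset$ for all $e\in E$. For $n\in\mathbb N$ let $[n]=\{0,\dots,n-1\}$ with natural order and $+^{[n]}=\{(a,b,c)\in[n]^3:c=a+b\}$, $\times^{[n]}=\{(a,b,c)\in[n]^3:c=ab\}$. A finite $\tau$-structure has built-in addition and multiplication if its $\{<,+,\times\}$-reduct is isomorphic to $([n],<^{[n]},+^{[n]},\times^{[n]})$; $\mathrm{ARITHM}[\tau]$ is the class of these. $C(m)=\{\overline\ell:\ell<m\}$ are new constants, and $\mathbf A_{C(m)}$ interprets $\overline\ell$ as the element corresponding to $\ell$ if $\ell<|A|$, else to $|A|-1$. $\mathrm{FO}_q$ is the set of first-order sentences of quantifier rank at most $q$. A parameterized problem $Q\subseteq\mathrm{ARITHM}[\tau]\times\mathbb N$ (slices closed under isomorphism) is slicewise definable in $\mathrm{FO}_q$ if there are computable $h$ and $f$ with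 $f(k)$ an $\mathrm{FO}_q[\tau\cup C(h(k))]$-sentence such that $(\mathbf A,k)\in Q\iff\mathbf A_{C(h(k))}\models f(k)$ for all $(\mathbf A,k)$. $p\textsc{ - }d\textsc{ -Hitting-Set}$ is the parameterized problem over $\{E_0,\epsilon,<,+,\times\}$ consisting of the pairs $(\mathbf A,k)$ where the $\{E_0,\epsilon\}$-reduct of $\mathbf A$ is (the structure of) a hypergraph all of whose hyperedges have at most $d$ elements and which has a hitting set of size $k$. -}

module Defs where

open import Data.Nat using (ℕ; zero; suc; _+_; _*_; _≤_; _<ᵇ_; _≡ᵇ_)
open import Data.Fin using (Fin; toℕ; splitAt)
import Data.Fin as F
open import Data.Fin.Subset using (Subset; _∈_; ∣_∣; Nonempty)
open import Data.Vec using (lookup)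
open import Data.Bool using (Bool; true; false; T; _∧_)
open import Data.Sum using (_⊎_; inj₁; inj₂)
open import Data.Product using (Σ; ∃; _×_; _,_)
open import Data.Empty using (⊥)
open import Relation.Nullary using (¬_)
open import Relation.Binary.PropositionalEquality using (_≡_)
open import Function.Bundles using (_↔_; Inverse; _⇔_)
open import Function.Definitions using (Injective)

-- Finite structures over τ = {E₀, ε, <, +, ×}, universe Fin N.
-- Relations are Boolean-valued (finite structures, so this is faithful).

record Structure (N : ℕ) : Set where
  field
    E₀  : Fin N → Bool
    ε   : Fin N → Fin N → Bool
    lt  : Fin N → Fin N → Bool
    add : Fin N → Fin N → Fin N → Bool
    mul : Fin N → Fin N → Fin N → Bool
open Structure public

natLt : ∀ {N} → Fin N → Fin N → Bool
natLt a b = toℕ a <ᵇ toℕ b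

natAdd : ∀ {N} → Fin N → Fin N → Fin N → Bool
natAdd a b c = toℕ c ≡ᵇ (toℕ a + toℕ b)

natMul : ∀ {N} → Fin N → Fin N → Fin N → Bool
natMul a b c = toℕ c ≡ᵇ (toℕ a * toℕ b)

-- An isomorphism of the {<,+,×}-reduct of A onto ([N],<,+,×).
-- A structure has built-in addition and multiplication iff such an
-- isomorphism exists (ARITHM[τ]).  Inverse.to π x is the number that
-- the element x corresponds to.
record ArithIso {N : ℕ} (A : Structure N) : Set where
  field
    π      : Fin N ↔ Fin N
    presLt  : ∀ x y → lt A x y ≡ natLt (Inverse.to π x) (Inverse.to π y)
    presAdd : ∀ x y z → add A x y z ≡ natAdd (Inverse.to π x) (Inverse.to π y) (Inverse.to π z)
    presMul : ∀ x y z → mul A x y z ≡ natMul (Inverse.to π x) (Inverse.to π y) (Inverse.to π z)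
open ArithIso public

data Term (m v : ℕ) : Set where
  var : Fin v → Term m v
  con : Fin m → Term m v

data Formula (m : ℕ) : ℕ → Set where
  _≐_  : ∀ {v} → Term m v → Term m v → Formula m v
  E₀'  : ∀ {v} → Term m v → Formula m v
  ε'   : ∀ {v} → Term m v → Term m v → Formula m v
  lt'  : ∀ {v} → Term m v → Term m v → Formula m v
  add' : ∀ {v} → Term m v → Term m v → Term m v → Formula m v
  mul' : ∀ {v} → Term m v → Term m v → Term m v → Formula m v
  ¬'   : ∀ {v} → Formula m v → Formula m v
  _∧'_ : ∀ {v} → Formula m v → Formula m v → Formula m v
  _∨'_ : ∀ {v} → Formula m v → Formula m v → Formula m v
  ∃'   : ∀ {v} → Formula m (suc v) → Formula m v
  ∀'   : ∀ {v} → Formula m (suc v) → Formula m v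

Sentence : ℕ → Set
Sentence m = Formula m 0

qr : ∀ {m v} → Formula m v → ℕ
qr (_ ≐ _)       = 0
qr (E₀' _)       = 0
qr (ε' _ _)      = 0
qr (lt' _ _)     = 0
qr (add' _ _ _)  = 0
qr (mul' _ _ _)  = 0
qr (¬' φ)        = qr φ
qr (φ ∧' ψ)      = qr φ Data.Nat.⊔ qr ψ
qr (φ ∨' ψ)      = qr φ Data.Nat.⊔ qr ψ
qr (∃' φ)        = suc (qr φ)
qr (∀' φ)        = suc (qr φ)

_▷_ : ∀ {N v} → (Fin v → Fin N) → Fin N → Fin (suc v) → Fin N
(ρ ▷ a) F.zero    = a
(ρ ▷ a) (F.suc i) = ρ i

module _ {N m : ℕ} (A : Structure N) (c : Fin m → Fin N) where
  ⟦_⟧t : ∀ {v} → Term m v → (Fin v → Fin N) → Fin N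
  ⟦ var i ⟧t ρ = ρ i
  ⟦ con l ⟧t ρ = c l

  Sat : ∀ {v} → Formula m v → (Fin v → Fin N) → Set
  Sat (s ≐ t) ρ        = ⟦ s ⟧t ρ ≡ ⟦ t ⟧t ρ
  Sat (E₀' s) ρ        = T (E₀ A (⟦ s ⟧t ρ))
  Sat (ε' s t) ρ       = T (ε A (⟦ s ⟧t ρ) (⟦ t ⟧t ρ))
  Sat (lt' s t) ρ      = T (lt A (⟦ s ⟧t ρ) (⟦ t ⟧t ρ))
  Sat (add' s t u) ρ   = T (add A (⟦ s ⟧t ρ) (⟦ t ⟧t ρ) (⟦ u ⟧t ρ))
  Sat (mul' s t u) ρ   = T (mul A (⟦ s ⟧t ρ) (⟦ t ⟧t ρ) (⟦ u ⟧t ρ))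
  Sat (¬' φ) ρ         = ¬ Sat φ ρ
  Sat (φ ∧' ψ) ρ       = Sat φ ρ × Sat ψ ρ
  Sat (φ ∨' ψ) ρ       = Sat φ ρ ⊎ Sat ψ ρ
  Sat (∃' φ) ρ         = Σ (Fin N) λ a → Sat φ (ρ ▷ a)
  Sat (∀' φ) ρ         = (a : Fin N) → Sat φ (ρ ▷ a)

noVars : ∀ {N} → Fin 0 → Fin N
noVars ()

clamp : ℕ → (n : ℕ) → Fin (suc n)
clamp zero    n       = F.zero
clamp (suc l) zero    = F.zero
clamp (suc l) (suc n) = F.suc (clamp l n)

-- Interpretation of C(m) in A_{C(m)}: ℓ̄ ↦ element corresponding to ℓ if
-- ℓ < |A|, else to |A|-1.  (|A| = suc n.)
constInterp : ∀ {n} {A : Structure (suc n)} → ArithIso A → (m : ℕ) → Fin m → Fin (suc n)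
constInterp {n} w m l = Inverse.from (π w) (clamp (toℕ l) n)

_,_[_]⊨_ : ∀ {n} (A : Structure (suc n)) → ArithIso A → (m : ℕ) → Sentence m → Set
A , w [ m ]⊨ φ = Sat A (constInterp w m) φ noVars

-- Parameterized problems over ARITHM[τ] (nonempty finite structures
-- with universe Fin (suc n)).  Membership of (A,k) is a predicate of A
-- and k.

Problem : Set₁
Problem = ∀ {n} → Structure (suc n) → ℕ → Set

-- slicewise definable in FO_q;  h, f are Agda functions (hence computable)
SlicewiseDefinable : ℕ → Problem → Set
SlicewiseDefinable q Q =
  Σ (ℕ → ℕ) λ h →
  Σ ((k : ℕ) → Sentence (h k)) λ f →
    ((k : ℕ) → qr (f k) ≤ q) ×
    (∀ {n} (A : Structure (suc n)) (w : ArithIso A) (k : ℕ) →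
       Q A k ⇔ (A , w [ h k ]⊨ f k))

record Hypergraph : Set where
  field
    nv ne    : ℕ
    edge     : Fin ne → Subset nv
    nonempty : ∀ e → Nonempty (edge e)
    distinct : Injective _≡_ _≡_ edge
open Hypergraph public

GE₀ : (G : Hypergraph) → Fin (nv G + ne G) → Bool
GE₀ G x with splitAt (nv G) x
... | inj₁ _ = false
... | inj₂ _ = true

Gε : (G : Hypergraph) → Fin (nv G + ne G) → Fin (nv G + ne G) → Bool
Gε G x y with splitAt (nv G) x | splitAt (nv G) y
... | inj₁ v | inj₂ e = lookup (edge G e) v
... | _      | _      = false

record ReductIso {N : ℕ} (A : Structure N) (G : Hypergraph) : Set where
  field
    σ     : Fin N ↔ Fin (nv G + ne G)
    presE₀ : ∀ x → E₀ A x ≡ GE₀ G (Inverse.to σ x)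
    presε  : ∀ x y → ε A x y ≡ Gε G (Inverse.to σ x) (Inverse.to σ y)

EdgesAtMost : ℕ → Hypergraph → Set
EdgesAtMost d G = ∀ e → ∣ edge G e ∣ ≤ d

HittingSet : (G : Hypergraph) → Subset (nv G) → Set
HittingSet G H = ∀ e → ∃ λ v → v ∈ H × v ∈ edge G e

HasHittingSetOfSize : Hypergraph → ℕ → Set
HasHittingSetOfSize G k = ∃ λ H → HittingSet G H × ∣ H ∣ ≡ k

pHittingSet : ℕ → Problem
pHittingSet d A k =
  ∃ λ (G : Hypergraph) → ReductIso A G × EdgesAtMost d G × HasHittingSetOfSize G k

{-# OPTIONS --safe #-}
module Submission where

-- Counting.  "At least n elements satisfy φ" costs only O(1) quantifiers on top of φ: for n distinct
-- numbers x_l below N there are b, c, d below N such that x_i mod d = c mod (1 + (s + l) b) iff i = l.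
-- Here d separates the x_l and is so small (a bounded root of N) that Gödel's β-function can store all
-- n residues in the single number c.  If N is too small for this, every element is named by a constant.
--
-- Kernel.  Edges are listed as d-tuples, and tuple lengths i = d-1, …, 1 are treated in turn.  A set x of
-- i elements is heavy if too many further elements lie together with x in a member of the current family
-- F; every hitting set of size at most k then meets x, because a single element outside x can account for
-- few of them, the (i+1)-sets being light already.  All members of F containing x are replaced by x
-- itself, which costs d + O(1) quantifiers; the d rounds give O(d²).  The final family covers a number of
-- elements bounded in terms of k and d (or there is no solution), and a solution inside it is guessed by
-- the same colouring that is used for counting.

open import Defs
open import Data.Nat hiding (_≟_)
open import Data.Nat.Properties hiding (_≟_; suc-injective)
open import Data.Nat.Divisibility
open import Data.Nat.DivMod
open import Data.Nat.Coprimality using (Coprime; coprime-divisor; coprime-Bézout; 1-coprimeTo) renaming (sym to coprime-sym)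
open import Data.Nat.GCD using (module Bézout)
open import Data.Nat.ListAction using (product)
open import Data.Nat.ListAction.Properties using (∈⇒∣product; product≢0)
open import Data.Nat.Tactic.RingSolver using (solve-∀)
open import Data.Bool using (Bool; true; false; T)
open import Data.Bool.Properties using (T?)
open import Data.Empty using (⊥-elim)
open import Data.Fin using (Fin; zero; suc; toℕ; fromℕ<; inject≤; cast; splitAt; join; _↑ˡ_; _↑ʳ_)
open import Data.Fin.Properties using (toℕ<n; toℕ-injective; toℕ-fromℕ<; fromℕ<-toℕ; any?; all?; ¬∀⟶∃¬; ¬Fin0; _≟_; suc-injective; injective⇒≤; inject≤-injective; cast-involutive; toℕ-cast; splitAt-↑ˡ; splitAt-↑ʳ; splitAt-join; join-splitAt; +↔⊎)
open import Data.Fin.Subset using (Subset; ∣_∣; inside; outside) renaming (_∈_ to _∈ₛ_; _⊆_ to _⊆ₛ_)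
open import Data.Fin.Subset.Properties using (∣p∣≤n)
open import Data.List using (List; []; _∷_; length; filter; allFin; concatMap) renaming (lookup to lookupₗ; tabulate to tabulateₗ; map to mapₗ)
open import Data.List.Properties using (length-++; length-map; length-tabulate)
open import Data.List.Membership.Propositional using (_∈_; find; lose)
open import Data.List.Membership.Propositional.Properties using (∈-tabulate⁺; ∈-tabulate⁻; ∈-map⁺; ∈-map⁻; ∈-filter⁺; ∈-filter⁻; ∈-allFin; ∈-lookup; ∈-concatMap⁺)
open import Data.List.Relation.Unary.All as All using (All; []; _∷_)
open import Data.List.Relation.Unary.All.Properties using (tabulate⁺)
open import Data.List.Relation.Unary.AllPairs using ([]; _∷_)
open import Data.List.Relation.Unary.Any as Any using (here; there; index)
open import Data.List.Relation.Unary.Any.Properties using (lookup-index)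
open import Data.List.Relation.Unary.Unique.Propositional using (Unique)
open import Data.List.Relation.Unary.Unique.Propositional.Properties using (filter⁺; allFin⁺; map⁺)
open import Data.Product using (Σ; ∃; _×_; _,_; proj₁; proj₂)
open import Data.Product.Function.NonDependent.Propositional using (_×-⇔_)
open import Data.Sum using (_⊎_; inj₁; inj₂; [_,_]′; map₁; map₂)
open import Data.Sum.Function.Propositional using (_⊎-⇔_)
open import Data.Sum.Properties using (inj₁-injective; inj₂-injective)
open import Data.Unit using (⊤; tt)
open import Data.Vec using (Vec; []; _∷_; lookup; head; tail; take; drop; _++_; map; tabulate; here; there)
open import Data.Vec.Properties using (lookup-map; lookup∘tabulate; tabulate∘lookup; tabulate-cong; []=⇒lookup; lookup⇒[]=)
open import Function.Base using (_∘_)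
open import Function.Bundles using (_⇔_; mk⇔; Equivalence; Inverse; _↔_; mk↔ₛ′)
open import Function.Construct.Composition using (_↔-∘_)
open import Function.Construct.Symmetry using (↔-sym)
open import Function.Definitions using (Injective)
open import Function.Properties.Equivalence using () renaming (refl to ⇔-refl; sym to ⇔-sym; trans to ⇔-trans)
open import Relation.Binary.PropositionalEquality
open import Relation.Nullary using (¬_; Dec; yes; no; contradiction)
open import Relation.Nullary.Decidable using (decidable-stable; ¬?; _×-dec_; _⊎-dec_; ⌊_⌋; toWitness; fromWitness) renaming (map to map-dec)
open import Relation.Unary using (Decidable)

open Equivalence using (to; from)

-- Gödel's β-function and separating moduli

-- The obstacle is that the rank may depend on `d` but not on `k`, so neither the `n` witnesses of a
-- count nor the `k` vertices of a solution can be quantified one inside the other. Constants and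
-- finite conjunctions and disjunctions do not contribute to the rank; all dependence on `k` is
-- pushed into them. What is quantified jointly is just the triple b, c, d, which defines all colour
-- classes at once.
--
-- Every family is defined by a formula containing the previous one. Its many occurrences stand side
-- by side, in the branches of finite disjunctions, so they multiply the length of the formula but
-- only add to its rank.

∏ : (ℕ → ℕ) → ℕ → ℕ
∏ f zero    = 1
∏ f (suc n) = ∏ f n * f n

coprime-* : ∀ {m n q} → Coprime m q → Coprime n q → Coprime (m * n) q
coprime-* m⊥q n⊥q (d∣mn , d∣q) =
  n⊥q (coprime-divisor (λ (e∣d , e∣m) → m⊥q (e∣m , ∣-trans e∣d d∣q)) d∣mn , d∣q)

coprime-∏ : ∀ f n {q} → (∀ i → i < n → Coprime (f i) q) → Coprime (∏ f n) q
coprime-∏ f zero    _ = 1-coprimeTo _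
coprime-∏ f (suc n) p =
  coprime-* (coprime-∏ f n λ i i<n → p i (m<n⇒m<1+n i<n)) (p n ≤-refl)

coprime-*-∣ : ∀ {m n o} → Coprime m n → m ∣ o → n ∣ o → m * n ∣ o
coprime-*-∣ {m} {n} m⊥n (divides q refl) n∣o =
  subst (m * n ∣_) (*-comm m q)
    (*-monoʳ-∣ m (coprime-divisor (coprime-sym m⊥n) (subst (n ∣_) (*-comm q m) n∣o)))

PairwiseCoprime : (ℕ → ℕ) → ℕ → Set
PairwiseCoprime f n = ∀ i j → i < j → j < n → Coprime (f i) (f j)

pairwise-pred : ∀ {f n} → PairwiseCoprime f (suc n) → PairwiseCoprime f n
pairwise-pred p i j i<j j<n = p i j i<j (m<n⇒m<1+n j<n)

∏-∣ : ∀ f n {o} → PairwiseCoprime f n → (∀ i → i < n → f i ∣ o) → ∏ f n ∣ o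
∏-∣ f zero    p f∣o = 1∣ _
∏-∣ f (suc n) p f∣o = coprime-*-∣
  (coprime-∏ f n λ i i<n → p i n i<n ≤-refl)
  (∏-∣ f n (pairwise-pred p) λ i i<n → f∣o i (m<n⇒m<1+n i<n))
  (f∣o n ≤-refl)

∏-lower : ∀ f n {b} → (∀ i → i < n → b ≤ f i) → b ^ n ≤ ∏ f n
∏-lower f zero    b≤ = ≤-refl
∏-lower f (suc n) {b} b≤ = ≤-trans (≤-reflexive (*-comm b (b ^ n)))
  (*-mono-≤ (∏-lower f n λ i i<n → b≤ i (m<n⇒m<1+n i<n)) (b≤ n ≤-refl))

∏-upper : ∀ f n {b} → (∀ i → i < n → f i ≤ b) → ∏ f n ≤ b ^ n
∏-upper f zero    ≤b = ≤-refl
∏-upper f (suc n) {b} ≤b = ≤-trans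
  (*-mono-≤ (∏-upper f n λ i i<n → ≤b i (m<n⇒m<1+n i<n)) (≤b n ≤-refl))
  (≤-reflexive (*-comm (b ^ n) b))

product-upper : ∀ {b} xs → All (_≤ b) xs → product xs ≤ b ^ length xs
product-upper []       []         = ≤-refl
product-upper (x ∷ xs) (x≤ ∷ xs≤) = *-mono-≤ x≤ (product-upper xs xs≤)

-- Subtraction is avoided: with q = q′ + 1, multiplication by q′ is negation modulo q. Bézout's
-- identity makes x either an inverse of p or the negative of one, and the witness is x (r - c) or x
-- (c - r) accordingly.
solve-congruence : ∀ {p q} .{{_ : NonZero q}} → Coprime p q → ∀ c r →
  ∃ λ s → (c + p * s) % q ≡ r % q
solve-congruence {p} {suc q′} p⊥q c r with coprime-Bézout p⊥q
... | Bézout.+- x y eq = x * (r + q′ * c) , (begin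
    (c + p * (x * (r + q′ * c))) % q        ≡⟨ cong (_% q) (rearrange p x c r q′) ⟩
    (c + x * p * (r + q′ * c)) % q          ≡⟨ cong (λ ◌ → (c + ◌ * (r + q′ * c)) % q) eq ⟨
    (c + (1 + y * q) * (r + q′ * c)) % q    ≡⟨ cong (_% q) (collect y c r q′) ⟩
    (r + (c + y * (r + q′ * c)) * q) % q    ≡⟨ [m+kn]%n≡m%n r (c + y * (r + q′ * c)) q ⟩
    r % q                                   ∎)
  where
  open ≡-Reasoning
  q = suc q′
  rearrange : ∀ p x c r q′ → c + p * (x * (r + q′ * c)) ≡ c + x * p * (r + q′ * c)
  rearrange = solve-∀
  collect : ∀ y c r q′ → c + (1 + y * suc q′) * (r + q′ * c) ≡ r + (c + y * (r + q′ * c)) * suc q′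
  collect = solve-∀
... | Bézout.-+ x y eq = x * z , (begin
    (c + p * (x * z)) % q             ≡⟨ [m+kn]%n≡m%n (c + p * (x * z)) r q ⟨
    (c + p * (x * z) + r * q) % q     ≡⟨ cong (_% q) (rearrange p x c r q′) ⟩
    (r + (1 + x * p) * z) % q         ≡⟨ cong (λ ◌ → (r + ◌ * z) % q) eq ⟩
    (r + y * q * z) % q               ≡⟨ cong (_% q) (collect y r z q′) ⟩
    (r + y * z * q) % q               ≡⟨ [m+kn]%n≡m%n r (y * z) q ⟩
    r % q                             ∎)
  where
  open ≡-Reasoning
  q = suc q′
  z = c + q′ * r
  rearrange : ∀ p x c r q′ → c + p * (x * (c + q′ * r)) + r * suc q′ ≡ r + (1 + x * p) * (c + q′ * r)
  rearrange = solve-∀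
  collect : ∀ y r z q′ → r + y * suc q′ * z ≡ r + y * z * suc q′
  collect = solve-∀

solve-congruence-< : ∀ {p q} .{{_ : NonZero q}} → Coprime p q → ∀ c r →
  ∃ λ s → s < q × (c + p * s) % q ≡ r % q
solve-congruence-< {p} {q} p⊥q c r with s , eq ← solve-congruence p⊥q c r =
  s % q , m%n<n s q , (begin
    (c + p * (s % q)) % q                     ≡⟨ [m+kn]%n≡m%n _ (p * (s / q)) q ⟨
    (c + p * (s % q) + p * (s / q) * q) % q   ≡⟨ cong (_% q) (collect c p (s % q) (s / q) q) ⟩
    (c + p * (s % q + s / q * q)) % q         ≡⟨ cong (λ ◌ → (c + p * ◌) % q) (m≡m%n+[m/n]*n s q) ⟨
    (c + p * s) % q                           ≡⟨ eq ⟩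
    r % q                                     ∎)
  where
  open ≡-Reasoning
  collect : ∀ c p a b q → c + p * a + p * b * q ≡ c + p * (a + b * q)
  collect = solve-∀

f∣∏ : ∀ f n i → i < n → f i ∣ ∏ f n
f∣∏ f (suc n) i i<1+n with m≤n⇒m<n∨m≡n (s≤s⁻¹ i<1+n)
... | inj₁ i<n  = ∣m⇒∣m*n (f n) (f∣∏ f n i i<n)
... | inj₂ refl = n∣m*n (∏ f n)

-- The moduli are given as successors, so that _%_ applies.
Remainders : (f y : ℕ → ℕ) → ℕ → ℕ → Set
Remainders f y n c =
  c < ∏ (λ i → suc (f i)) n × (∀ i → i < n → c % suc (f i) ≡ y i % suc (f i))

-- The summand P s does not disturb the earlier residues, since each earlier modulus divides P. The
-- bound on the solution belongs to the invariant because the code must be an element of the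
-- structure.
extend-remainders : ∀ f y n c s → Remainders f y n c → s < suc (f n) →
  (c + ∏ (λ i → suc (f i)) n * s) % suc (f n) ≡ y n % suc (f n) →
  Remainders f y (suc n) (c + ∏ (λ i → suc (f i)) n * s)
extend-remainders f y n c s (c< , c≡) s< s≡ = bound , residue
  where
  P = ∏ (λ i → suc (f i)) n
  bound : c + P * s < P * suc (f n)
  bound = begin-strict
    c + P * s     <⟨ +-monoˡ-< (P * s) c< ⟩
    P + P * s     ≡⟨ *-suc P s ⟨
    P * suc s     ≤⟨ *-monoʳ-≤ P s< ⟩
    P * suc (f n) ∎
    where open ≤-Reasoning
  residue : ∀ i → i < suc n → (c + P * s) % suc (f i) ≡ y i % suc (f i)
  residue i i<1+n with m≤n⇒m<n∨m≡n (s≤s⁻¹ i<1+n)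
  ... | inj₁ i<n  = trans (%-remove-+ʳ c (∣m⇒∣m*n s (f∣∏ _ n i i<n))) (c≡ i i<n)
  ... | inj₂ refl = s≡

chinese-remainder : (f y : ℕ → ℕ) → ∀ n → PairwiseCoprime (λ i → suc (f i)) n →
  ∃ (Remainders f y n)
chinese-remainder f y zero    p = 0 , s≤s z≤n , λ _ ()
chinese-remainder f y (suc n) p =
  let c , c-remainders = chinese-remainder f y n (pairwise-pred p)
      s , s< , s≡ = solve-congruence-< (coprime-∏ _ n λ i i<n → p i n i<n ≤-refl) c (y n)
  in  _ , extend-remainders f y n c s c-remainders s< s≡

-- A common divisor of 1 + i b and 1 + j b divides j - i, hence b, hence 1.
gödel-coprime : ∀ {b i j} → i < j → (j ∸ i) ∣ b → Coprime (suc (i * b)) (suc (j * b))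
gödel-coprime {b} {i} {j} i<j j-i∣b {d} (d∣i , d∣j) = ∣1⇒≡1 (∣m+n∣m⇒∣n {d} {i * b} {1}
    (subst (d ∣_) (+-comm 1 (i * b)) d∣i) (∣n⇒∣m*n i (∣-trans d∣j-i j-i∣b)))
  where
  identity : ∀ i k b → (i + k) * suc (i * b) ≡ i * suc ((i + k) * b) + k
  identity = solve-∀
  j≡ : i + (j ∸ i) ≡ j
  j≡ = m+[n∸m]≡n (<⇒≤ i<j)
  d∣j-i : d ∣ j ∸ i
  d∣j-i = ∣m+n∣m⇒∣n
    (subst (d ∣_) (identity i (j ∸ i) b) (∣n⇒∣m*n (i + (j ∸ i)) d∣i))
    (∣n⇒∣m*n i (subst (λ ◌ → d ∣ suc (◌ * b)) (sym j≡) d∣j))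

last-true : ∀ {P : ℕ → Set} → Decidable P → ∀ n → P 1 → ¬ P (suc n) →
  ∃ λ t → 1 ≤ t × P t × ¬ P (suc t)
last-true P? zero    p1 ¬p = contradiction p1 ¬p
last-true P? (suc n) p1 ¬p with P? (suc n)
... | yes p  = suc n , s≤s z≤n , p , ¬p
... | no ¬p′ = last-true P? n p1 ¬p′

%-≡⇒∣ : ∀ {m} .{{_ : NonZero m}} x y → x % m ≡ y % m → m ∣ ∣ x - y ∣
%-≡⇒∣ {m} x y eq = subst (m ∣_) (sym difference) (n∣m*n ∣ x / m - y / m ∣)
  where
  open ≡-Reasoning
  difference : ∣ x - y ∣ ≡ ∣ x / m - y / m ∣ * m
  difference = begin
    ∣ x - y ∣                                              ≡⟨ cong₂ ∣_-_∣ (m≡m%n+[m/n]*n x m) (m≡m%n+[m/n]*n y m) ⟩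
    ∣ x % m + x / m * m - y % m + y / m * m ∣              ≡⟨ cong (λ ◌ → ∣ x % m + x / m * m - ◌ + y / m * m ∣) eq ⟨
    ∣ x % m + x / m * m - x % m + y / m * m ∣              ≡⟨ ∣m+n-m+o∣≡∣n-o∣ (x % m) _ _ ⟩
    ∣ x / m * m - y / m * m ∣                              ≡⟨ *-distribʳ-∣-∣ m (x / m) (y / m) ⟨
    ∣ x / m - y / m ∣ * m                                  ∎

-- The choice of base, code and separating modulus

module Hashing (T : ℕ) where

  -- The base b will satisfy b ^ exponent < N ≤ b ^ (2 * exponent).  The T² distances then have a
  -- product at most b ^ (2 * exponent * T²), too small to be divisible by all 1 + j b with
  -- 1 ≤ j ≤ separators.
  exponent separators : ℕ
  exponent   = 2 * T + 2
  separators = suc (2 * exponent * (T * T))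

  abstract
    -- A factorial serves two purposes: it is divisible by all differences of multipliers, as the
    -- coprimality argument requires, and it is so large that 1 + i b ≤ b ^ 2 for every multiplier i
    -- and every b ≥ `factor`.
    factor : ℕ
    factor = suc (suc (separators + T)) !

    factor≥ : suc (suc (separators + T)) ≤ factor
    factor≥ = m≤m*n (suc (suc (separators + T))) (suc (separators + T) !) {{suc (separators + T) !≢0}}

    ≤⇒∣factor : ∀ i → suc i ≤ separators + T → suc i ∣ factor
    ≤⇒∣factor i i≤ = ∣-trans (m∣m*n (i !)) (m≤n⇒m!∣n! (≤-trans i≤ (m≤n+m (separators + T) 2)))

    -- The first summand lets t = 1 fit below N; the second ensures that all multipliers are named
    -- by constants.
    threshold : ℕ
    threshold = factor ^ exponent + suc (suc (separators + T))

    power<threshold : factor ^ exponent < threshold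
    power<threshold = m<m+n (factor ^ exponent) (s≤s z≤n)

    indices<threshold : suc (separators + T) < threshold
    indices<threshold = m≤n+m _ (factor ^ exponent)

  -- The multipliers 1, …, separators are the candidates for the separating modulus, the following
  -- ones are used for coding the residues.
  codeMultiplier : ℕ → ℕ
  codeMultiplier l = separators + suc l

  modulus : ℕ → ℕ → ℕ
  modulus b l = suc (codeMultiplier l * b)

  module _ {b} (factor∣b : factor ∣ b) where
    coprime : ∀ i j → i < j → j ≤ separators + T → Coprime (suc (i * b)) (suc (j * b))
    coprime i j i<j j≤ with j ∸ i in eq
    ... | zero  = contradiction (m∸n≡0⇒m≤n eq) (<⇒≱ i<j)
    ... | suc k = gödel-coprime i<j (subst (_∣ b) (sym eq)
      (∣-trans (≤⇒∣factor k (≤-trans (≤-reflexive (sym eq)) (≤-trans (m∸n≤m j i) j≤))) factor∣b))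

  record Hash (N : ℕ) (x : Fin T → ℕ) : Set where
    field
      base code modulus-1    : ℕ
      base<N      : base < N
      code<N      : code < N
      modulus-1<N : suc modulus-1 < N
      modulus<N   : ∀ (l : Fin T) → modulus base (toℕ l) < N
      separates   : ∀ (l i : Fin T) →
        (x i % suc modulus-1 ≡ code % modulus base (toℕ l)) ⇔ (l ≡ i)

  module _ {N} (threshold≤N : threshold ≤ N) (x : Fin T → ℕ)
           (x-injective : Injective _≡_ _≡_ x) (x<N : ∀ i → x i < N) where
    private
      fits : ℕ → Set
      fits t = (factor * t) ^ exponent < N

      factor<N : fits 1
      factor<N = <-≤-trans
        (subst (λ ◌ → ◌ ^ exponent < threshold) (sym (*-identityʳ factor)) power<threshold)
        threshold≤N

      instance
        factor≢0 : NonZero factor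
        factor≢0 = >-nonZero (≤-trans (s≤s z≤n) factor≥)

      exponent≡ : exponent ≡ suc (suc (2 * T))
      exponent≡ = +-comm (2 * T) 2

      overflow : ¬ fits (suc N)
      overflow = ≤⇒≯ (begin
        N                              ≤⟨ n≤1+n N ⟩
        suc N                          ≤⟨ m≤n*m (suc N) factor ⟩
        factor * suc N                 ≤⟨ m≤m*n _ ((factor * suc N) ^ suc (2 * T)) {{m^n≢0 _ (suc (2 * T)) {{m*n≢0 factor (suc N)}}}} ⟩
        (factor * suc N) ^ suc (suc (2 * T)) ≡⟨ cong ((factor * suc N) ^_) exponent≡ ⟨
        (factor * suc N) ^ exponent    ∎)
        where open ≤-Reasoning

      abstract
       maximal : ∃ λ t → 1 ≤ t × fits t × ¬ fits (suc t)
       maximal = last-true (λ t → _ <? N) N factor<N overflow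

      t = proj₁ maximal
      b = factor * t

      instance
        t≢0 : NonZero t
        t≢0 = >-nonZero (proj₁ (proj₂ maximal))
        b≢0 : NonZero b
        b≢0 = m*n≢0 factor t

      factor≤b : factor ≤ b
      factor≤b = m≤m*n factor t

      indices≤b : suc (suc (separators + T)) ≤ b
      indices≤b = ≤-trans factor≥ factor≤b

      2≤b : 2 ≤ b
      2≤b = ≤-trans (s≤s (s≤s z≤n)) indices≤b

      b²≡ : b * b ≡ b ^ 2
      b²≡ = cong (b *_) (sym (*-identityʳ b))

      small-modulus : ∀ {i} → i ≤ separators + T → suc (i * b) ≤ b ^ 2
      small-modulus {i} i≤ = begin
        suc (i * b)  ≤⟨ +-monoˡ-≤ (i * b) (≤-trans (s≤s z≤n) 2≤b) ⟩
        b + i * b    ≤⟨ *-monoˡ-≤ b (≤-trans (s≤s i≤) (≤-trans (n≤1+n _) indices≤b)) ⟩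
        b * b        ≡⟨ b²≡ ⟩
        b ^ 2        ∎
        where open ≤-Reasoning

      ^<N : ∀ {i} → i ≤ exponent → b ^ i < N
      ^<N i≤ = ≤-<-trans (^-monoʳ-≤ b i≤) (proj₁ (proj₂ (proj₂ maximal)))

      -- This is the maximality of t: the next candidate factor * (t + 1) = factor + b already
      -- overflows, and it is at most 2 b ≤ b ^ 2.
      N≤ : N ≤ b ^ (2 * exponent)
      N≤ = begin
        N                             ≤⟨ ≮⇒≥ (proj₂ (proj₂ (proj₂ maximal))) ⟩
        (factor * suc t) ^ exponent   ≡⟨ cong (_^ exponent) (*-suc factor t) ⟩
        (factor + b) ^ exponent       ≤⟨ ^-monoˡ-≤ exponent (+-monoˡ-≤ b factor≤b) ⟩
        (b + b) ^ exponent            ≡⟨ cong (λ ◌ → (b + ◌) ^ exponent) (+-identityʳ b) ⟨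
        (2 * b) ^ exponent            ≤⟨ ^-monoˡ-≤ exponent (*-monoˡ-≤ b 2≤b) ⟩
        (b * b) ^ exponent            ≡⟨ cong (_^ exponent) b²≡ ⟩
        (b ^ 2) ^ exponent            ≡⟨ ^-*-assoc b 2 exponent ⟩
        b ^ (2 * exponent)            ∎
        where open ≤-Reasoning

      distance : Fin T → Fin T → ℕ
      distance i j = ∣ x i - x j ∣ ⊔ 1  -- the diagonal must not annihilate the product

      distance≤ : ∀ i j → distance i j ≤ b ^ (2 * exponent)
      distance≤ i j = ⊔-lub
        (≤-trans (∣m-n∣≤m⊔n (x i) (x j)) (⊔-lub (≤-trans (<⇒≤ (x<N i)) N≤) (≤-trans (<⇒≤ (x<N j)) N≤)))
        (m^n>0 b (2 * exponent))

      row : Fin T → ℕ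
      row i = product (tabulateₗ (distance i))

      distances : ℕ
      distances = product (tabulateₗ row)

      distance≢0 : ∀ i j → NonZero (distance i j)
      distance≢0 i j = >-nonZero (m≤n⊔m ∣ x i - x j ∣ 1)

      distances≢0 : NonZero distances
      distances≢0 = product≢0 (tabulate⁺ λ i → product≢0 (tabulate⁺ (distance≢0 i)))

      distance∣ : ∀ i j → distance i j ∣ distances
      distance∣ i j = ∣-trans (∈⇒∣product (∈-tabulate⁺ {f = distance i} j)) (∈⇒∣product (∈-tabulate⁺ {f = row} i))

      product-tabulate≤ : ∀ {m c} (f : Fin m → ℕ) → (∀ i → f i ≤ c) → product (tabulateₗ f) ≤ c ^ m
      product-tabulate≤ {m} {c} f f≤ = subst (λ ◌ → product (tabulateₗ f) ≤ c ^ ◌) (length-tabulate f)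
        (product-upper (tabulateₗ f) (tabulate⁺ f≤))

      distances≤ : distances ≤ b ^ (2 * exponent * (T * T))
      distances≤ = begin
        distances                          ≤⟨ product-tabulate≤ row (λ i → product-tabulate≤ (distance i) (distance≤ i)) ⟩
        ((b ^ (2 * exponent)) ^ T) ^ T     ≡⟨ ^-*-assoc (b ^ (2 * exponent)) T T ⟩
        (b ^ (2 * exponent)) ^ (T * T)     ≡⟨ ^-*-assoc b (2 * exponent) (T * T) ⟩
        b ^ (2 * exponent * (T * T))       ∎
        where open ≤-Reasoning

      Collides : Fin separators → Set
      Collides j = ∃ λ i → ∃ λ i′ → suc (suc (toℕ j) * b) ∣ distance i i′

      separator : ℕ → ℕ
      separator j = suc (suc j * b)

      factor∣b : factor ∣ b
      factor∣b = m∣m*n t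

      -- If each candidate modulus divided some distance, then so would their product divide the
      -- product of all distances, the candidates being pairwise coprime. But the former is at least
      -- b ^ separators, one power of b above the bound on the latter.
      ¬all-collide : ¬ (∀ j → Collides j)
      ¬all-collide collide = <⇒≱ (^-monoʳ-< b 2≤b (n<1+n (2 * exponent * (T * T)))) (begin
        b ^ separators          ≤⟨ ∏-lower separator separators (λ j _ → ≤-trans (m≤m+n b (j * b)) (n≤1+n _)) ⟩
        ∏ separator separators  ≤⟨ ∣⇒≤ {{distances≢0}} (∏-∣ separator separators
                                     (λ i j i<j j< → coprime factor∣b (suc i) (suc j) (s≤s i<j) (≤-trans j< (m≤m+n separators T)))
                                     divides-distances) ⟩
        distances               ≤⟨ distances≤ ⟩
        b ^ (2 * exponent * (T * T)) ∎)
        where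
        open ≤-Reasoning
        divides-distances : ∀ j → j < separators → separator j ∣ distances
        divides-distances j j< with i , i′ , j∣ ← collide (fromℕ< j<) =
          ∣-trans (subst (λ ◌ → separator ◌ ∣ distance i i′) (toℕ-fromℕ< j<) j∣) (distance∣ i i′)

      separating : ∃ λ j → ¬ Collides j
      separating = ¬∀⟶∃¬ separators Collides
        (λ j → any? λ i → any? λ i′ → suc (suc (toℕ j) * b) ∣? distance i i′) ¬all-collide

      j₀ = toℕ (proj₁ separating)
      m  = separator j₀

      residue : ℕ → ℕ
      residue l with l <? T
      ... | yes l<T = x (fromℕ< l<T) % m
      ... | no  _   = 0

      residue-toℕ : ∀ l → residue (toℕ l) ≡ x l % m
      residue-toℕ l with toℕ l <? T
      ... | yes l<T = cong (λ ◌ → x ◌ % m) (fromℕ<-toℕ l l<T)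
      ... | no  l≮T = contradiction (toℕ<n l) l≮T

      remainder : ∃ (Remainders (λ l → codeMultiplier l * b) residue T)
      remainder = chinese-remainder (λ l → codeMultiplier l * b) residue T
        λ i j i<j j<T → coprime factor∣b _ _ (+-monoʳ-< separators (s≤s i<j)) (+-monoʳ-≤ separators j<T)

      c = proj₁ remainder

      modulus≤ : ∀ l → l < T → modulus b l ≤ b ^ 2
      modulus≤ l l<T = small-modulus (+-monoʳ-≤ separators l<T)

      b²<N : b ^ 2 < N
      b²<N = ^<N (m≤n+m 2 (2 * T))

      -- The coding multipliers come after the separating ones for this reason: a residue modulo `m`
      -- is then smaller than every coding modulus, so `code-residue` recovers it exactly and not
      -- merely up to a congruence.
      m≤modulus : ∀ l → m ≤ modulus b l
      m≤modulus l = s≤s (*-monoˡ-≤ b (≤-trans (toℕ<n (proj₁ separating)) (m≤m+n separators (suc l))))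

      code-residue : ∀ (l : Fin T) → c % modulus b (toℕ l) ≡ x l % m
      code-residue l = begin
        c % modulus b (toℕ l)                ≡⟨ proj₂ (proj₂ remainder) (toℕ l) (toℕ<n l) ⟩
        residue (toℕ l) % modulus b (toℕ l)  ≡⟨ cong (_% modulus b (toℕ l)) (residue-toℕ l) ⟩
        x l % m % modulus b (toℕ l)          ≡⟨ m<n⇒m%n≡m (<-≤-trans (m%n<n (x l) m) (m≤modulus (toℕ l))) ⟩
        x l % m                              ∎
        where open ≡-Reasoning

      separated : ∀ l i → x i % m ≡ x l % m → l ≡ i
      separated l i eq = decidable-stable (l ≟ i) λ l≢i → proj₂ separating
        (i , l , subst (m ∣_) (sym (m≥n⇒m⊔n≡m (n≢0⇒n>0 λ d≡0 → l≢i (sym (x-injective (∣m-n∣≡0⇒m≡n d≡0))))))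
          (%-≡⇒∣ (x i) (x l) eq))

    hash : Hash N x
    hash = record
      { base = b
      ; code = c
      ; modulus-1 = suc j₀ * b
      ; base<N = ≤-<-trans (m≤m*n b (b ^ 1) {{m^n≢0 b 1}}) b²<N
      -- The code lies below a product of T moduli, each at most b ^ 2. Hence the 2 * T in
      -- `exponent`; the additional 2 keeps the moduli themselves below N.
      ; code<N = begin-strict
          c                    <⟨ proj₁ (proj₂ remainder) ⟩
          ∏ (modulus b) T      ≤⟨ ∏-upper (modulus b) T modulus≤ ⟩
          (b ^ 2) ^ T          ≡⟨ ^-*-assoc b 2 T ⟩
          b ^ (2 * T)          <⟨ ^<N (m≤m+n (2 * T) 2) ⟩
          N                    ∎
      ; modulus-1<N = ≤-<-trans (small-modulus (≤-trans (toℕ<n (proj₁ separating)) (m≤m+n separators T))) b²<N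
      ; modulus<N = λ l → ≤-<-trans (modulus≤ (toℕ l) (toℕ<n l)) b²<N
      ; separates = λ l i → mk⇔
          (λ eq → separated l i (trans eq (code-residue l)))
          (λ { refl → sym (code-residue l) })
      }
      where open ≤-Reasoning

-- Definable predicates

cong₃ : ∀ {X Y Z W : Set} (f : X → Y → Z → W) {x x′ y y′ z z′} →
  x ≡ x′ → y ≡ y′ → z ≡ z′ → f x y z ≡ f x′ y′ z′
cong₃ f refl refl refl = refl

≡⇒⇔ : ∀ {X Y : Set} → X ≡ Y → X ⇔ Y
≡⇒⇔ refl = ⇔-refl

¬-⇔ : ∀ {X Y : Set} → X ⇔ Y → (¬ X) ⇔ (¬ Y)
¬-⇔ e = mk⇔ (λ ¬x y → ¬x (from e y)) (λ ¬y x → ¬y (to e x))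

Σ-⇔ : ∀ {I : Set} {X Y : I → Set} → (∀ i → X i ⇔ Y i) → Σ I X ⇔ Σ I Y
Σ-⇔ e = mk⇔ (λ (i , x) → i , to (e i) x) (λ (i , y) → i , from (e i) y)

Π-⇔ : ∀ {I : Set} {X Y : I → Set} → (∀ i → X i ⇔ Y i) → (∀ i → X i) ⇔ (∀ i → Y i)
Π-⇔ e = mk⇔ (λ f i → to (e i) (f i)) (λ f i → from (e i) (f i))

module _ {m : ℕ} where

  weakenₜ : ∀ {v} → Term m v → Term m (suc v)
  weakenₜ (var i) = var (suc i)
  weakenₜ (con l) = con l

  liftₛ : ∀ {u v} → (Fin u → Term m v) → Fin (suc u) → Term m (suc v)
  liftₛ s zero    = var zero
  liftₛ s (suc i) = weakenₜ (s i)

  substₜ : ∀ {u v} → (Fin u → Term m v) → Term m u → Term m v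
  substₜ s (var i) = s i
  substₜ s (con l) = con l

  substitute : ∀ {u v} → (Fin u → Term m v) → Formula m u → Formula m v
  substitute s (t₁ ≐ t₂)        = substₜ s t₁ ≐ substₜ s t₂
  substitute s (E₀' t)          = E₀' (substₜ s t)
  substitute s (ε' t₁ t₂)       = ε' (substₜ s t₁) (substₜ s t₂)
  substitute s (lt' t₁ t₂)      = lt' (substₜ s t₁) (substₜ s t₂)
  substitute s (add' t₁ t₂ t₃)  = add' (substₜ s t₁) (substₜ s t₂) (substₜ s t₃)
  substitute s (mul' t₁ t₂ t₃)  = mul' (substₜ s t₁) (substₜ s t₂) (substₜ s t₃)
  substitute s (¬' φ)           = ¬' (substitute s φ)
  substitute s (φ ∧' ψ)         = substitute s φ ∧' substitute s ψ
  substitute s (φ ∨' ψ)         = substitute s φ ∨' substitute s ψ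
  substitute s (∃' φ)           = ∃' (substitute (liftₛ s) φ)
  substitute s (∀' φ)           = ∀' (substitute (liftₛ s) φ)

  qr-substitute : ∀ {u v} (s : Fin u → Term m v) φ → qr (substitute s φ) ≡ qr φ
  qr-substitute s (_ ≐ _)      = refl
  qr-substitute s (E₀' _)      = refl
  qr-substitute s (ε' _ _)     = refl
  qr-substitute s (lt' _ _)    = refl
  qr-substitute s (add' _ _ _) = refl
  qr-substitute s (mul' _ _ _) = refl
  qr-substitute s (¬' φ)       = qr-substitute s φ
  qr-substitute s (φ ∧' ψ)     = cong₂ _⊔_ (qr-substitute s φ) (qr-substitute s ψ)
  qr-substitute s (φ ∨' ψ)     = cong₂ _⊔_ (qr-substitute s φ) (qr-substitute s ψ)
  qr-substitute s (∃' φ)       = cong suc (qr-substitute (liftₛ s) φ)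
  qr-substitute s (∀' φ)       = cong suc (qr-substitute (liftₛ s) φ)

  module _ {N : ℕ} (A : Structure N) (c : Fin m → Fin N) where

    private
      infix 9 _at_
      _at_ : ∀ {v} → Term m v → (Fin v → Fin N) → Fin N
      t at ρ = ⟦_⟧t A c t ρ

    weaken-at : ∀ {v} (t : Term m v) ρ a → weakenₜ t at (ρ ▷ a) ≡ t at ρ
    weaken-at (var i) ρ a = refl
    weaken-at (con l) ρ a = refl

    Represents : ∀ {u v} → (Fin u → Term m v) → (Fin v → Fin N) → (Fin u → Fin N) → Set
    Represents s ρ ρ′ = ∀ i → s i at ρ ≡ ρ′ i

    lift-represents : ∀ {u v} {s : Fin u → Term m v} {ρ ρ′} → Represents s ρ ρ′ →
      ∀ a → Represents (liftₛ s) (ρ ▷ a) (ρ′ ▷ a)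
    lift-represents rep a zero    = refl
    lift-represents {s = s} rep a (suc i) = trans (weaken-at (s i) _ a) (rep i)

    substₜ-at : ∀ {u v} {s : Fin u → Term m v} {ρ ρ′} → Represents s ρ ρ′ →
      ∀ t → substₜ s t at ρ ≡ t at ρ′
    substₜ-at rep (var i) = rep i
    substₜ-at rep (con l) = refl

    sat-substitute : ∀ {u v} {s : Fin u → Term m v} {ρ ρ′} → Represents s ρ ρ′ →
      ∀ φ → Sat A c (substitute s φ) ρ ⇔ Sat A c φ ρ′
    sat-substitute rep (t₁ ≐ t₂) = ≡⇒⇔ (cong₂ _≡_ (substₜ-at rep t₁) (substₜ-at rep t₂))
    sat-substitute rep (E₀' t) = ≡⇒⇔ (cong (T ∘ E₀ A) (substₜ-at rep t))
    sat-substitute rep (ε' t₁ t₂) =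
      ≡⇒⇔ (cong₂ (λ a b → T (ε A a b)) (substₜ-at rep t₁) (substₜ-at rep t₂))
    sat-substitute rep (lt' t₁ t₂) =
      ≡⇒⇔ (cong₂ (λ a b → T (lt A a b)) (substₜ-at rep t₁) (substₜ-at rep t₂))
    sat-substitute rep (add' t₁ t₂ t₃) = ≡⇒⇔
      (cong T (cong₃ (add A) (substₜ-at rep t₁) (substₜ-at rep t₂) (substₜ-at rep t₃)))
    sat-substitute rep (mul' t₁ t₂ t₃) = ≡⇒⇔
      (cong T (cong₃ (mul A) (substₜ-at rep t₁) (substₜ-at rep t₂) (substₜ-at rep t₃)))
    sat-substitute rep (¬' φ)   = ¬-⇔ (sat-substitute rep φ)
    sat-substitute rep (φ ∧' ψ) = sat-substitute rep φ ×-⇔ sat-substitute rep ψ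
    sat-substitute rep (φ ∨' ψ) = sat-substitute rep φ ⊎-⇔ sat-substitute rep ψ
    sat-substitute rep (∃' φ)   = Σ-⇔ λ a → sat-substitute (lift-represents rep a) φ
    sat-substitute rep (∀' φ)   = Π-⇔ λ a → sat-substitute (lift-represents rep a) φ

    sat-ext : ∀ {v} {ρ ρ′ : Fin v → Fin N} → (∀ i → ρ i ≡ ρ′ i) →
      ∀ φ → Sat A c φ ρ ⇔ Sat A c φ ρ′
    sat-ext eq φ = ⇔-trans
      (⇔-sym (sat-substitute {s = var} (λ _ → refl) φ))
      (sat-substitute {s = var} eq φ)

    sat? : ∀ {v} (φ : Formula m v) ρ → Dec (Sat A c φ ρ)
    sat? (t₁ ≐ t₂) ρ       = (t₁ at ρ) ≟ (t₂ at ρ)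
    sat? (E₀' t) ρ         = T? _
    sat? (ε' t₁ t₂) ρ      = T? _
    sat? (lt' t₁ t₂) ρ     = T? _
    sat? (add' t₁ t₂ t₃) ρ = T? _
    sat? (mul' t₁ t₂ t₃) ρ = T? _
    sat? (¬' φ) ρ          = ¬? (sat? φ ρ)
    sat? (φ ∧' ψ) ρ        = sat? φ ρ ×-dec sat? ψ ρ
    sat? (φ ∨' ψ) ρ        = sat? φ ρ ⊎-dec sat? ψ ρ
    sat? (∃' φ) ρ          = any? λ a → sat? φ (ρ ▷ a)
    sat? (∀' φ) ρ          = all? λ a → sat? φ (ρ ▷ a)

-- Structures with built-in arithmetic

record Arithmetical : Set where
  constructor arithmetical
  field
    {size-1}  : ℕ
    structure : Structure (suc size-1)
    iso       : ArithIso structure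
open Arithmetical public

Elem : Arithmetical → Set
Elem S = Fin (suc (size-1 S))

num : (S : Arithmetical) → Elem S → ℕ
num S x = toℕ (Inverse.to (π (iso S)) x)

num< : ∀ S x → num S x < suc (size-1 S)
num< S x = toℕ<n _

num-injective : ∀ S {x y} → num S x ≡ num S y → x ≡ y
num-injective S {x} {y} eq = begin
  x                                    ≡⟨ Inverse.strictlyInverseʳ (π (iso S)) x ⟨
  Inverse.from (π (iso S)) (Inverse.to (π (iso S)) x) ≡⟨ cong (Inverse.from (π (iso S))) (toℕ-injective eq) ⟩
  Inverse.from (π (iso S)) (Inverse.to (π (iso S)) y) ≡⟨ Inverse.strictlyInverseʳ (π (iso S)) y ⟩
  y                                    ∎
  where open ≡-Reasoning

element : ∀ S i → i < suc (size-1 S) → Elem S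
element S i i< = Inverse.from (π (iso S)) (fromℕ< i<)

num-element : ∀ S i (i< : i < suc (size-1 S)) → num S (element S i i<) ≡ i
num-element S i i< = trans (cong toℕ (Inverse.strictlyInverseˡ (π (iso S)) (fromℕ< i<))) (toℕ-fromℕ< i<)

Pred : ℕ → Set₁
Pred v = (S : Arithmetical) → Vec (Elem S) v → Set

toℕ-clamp : ∀ l n → l ≤ n → toℕ (clamp l n) ≡ l
toℕ-clamp zero    n       _       = refl
toℕ-clamp (suc l) (suc n) (s≤s p) = cong suc (toℕ-clamp l n p)

infix 4 _∈ᵥ_
_∈ᵥ_ : ∀ {X : Set} {n} → X → Vec X n → Set
x ∈ᵥ xs = ∃ λ i → lookup xs i ≡ x

lookup-take : ∀ {X : Set} d {v} (ρ : Vec X (d + v)) i → lookup ρ (i ↑ˡ v) ≡ lookup (take d ρ) i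
lookup-take (suc d) (x ∷ ρ) zero    = refl
lookup-take (suc d) (x ∷ ρ) (suc i) = lookup-take d ρ i

lookup-drop : ∀ {X : Set} d {v} (ρ : Vec X (d + v)) i → lookup ρ (d ↑ʳ i) ≡ lookup (drop d ρ) i
lookup-drop zero    ρ       i = refl
lookup-drop (suc d) (x ∷ ρ) i = lookup-drop d ρ i

take-++ : ∀ {X : Set} {d v} (z : Vec X d) (ρ : Vec X v) → take d (z ++ ρ) ≡ z
take-++ []      ρ = refl
take-++ (x ∷ z) ρ = cong (x ∷_) (take-++ z ρ)

drop-++ : ∀ {X : Set} {d v} (z : Vec X d) (ρ : Vec X v) → drop d (z ++ ρ) ≡ ρ
drop-++ []      ρ = refl
drop-++ (x ∷ z) ρ = drop-++ z ρ

module Definability (m-1 : ℕ) where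

  m : ℕ
  m = suc m-1

  constant : (S : Arithmetical) → Fin m → Elem S
  constant S = constInterp (iso S) m

  num-constant : ∀ S l → toℕ l ≤ size-1 S → num S (constant S l) ≡ toℕ l
  num-constant S l l≤ = trans (cong toℕ (Inverse.strictlyInverseˡ (π (iso S)) (clamp (toℕ l) (size-1 S))))
                              (toℕ-clamp (toℕ l) (size-1 S) l≤)

  eval : ∀ {v} S → Vec (Elem S) v → Term m v → Elem S
  eval S ρ t = ⟦_⟧t (structure S) (constant S) t (lookup ρ)

  Models : ∀ {v} S → Formula m v → (Fin v → Elem S) → Set
  Models S φ ρ = Sat (structure S) (constant S) φ ρ

  -- One formula has to work for all structures `S`, so the combinators below turn a semantic
  -- predicate into a uniform definition of it. The rank is only bounded by `r`, which lets the two
  -- sides of a connective share the index.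
  record Def (r : ℕ) {v} (P : Pred v) : Set where
    field
      formula : Formula m v
      rank≤   : qr formula ≤ r
      correct : ∀ S ρ → Models S formula (lookup ρ) ⇔ P S ρ
  open Def public

  record DefTerm {v} (t : ∀ S → Vec (Elem S) v → Elem S) : Set where
    field
      term  : Term m v
      sound : ∀ S ρ → eval S ρ term ≡ t S ρ
  open DefTerm public

  record DefTuple {u v} (p : ∀ S → Vec (Elem S) v → Vec (Elem S) u) : Set where
    field
      terms  : Fin u → Term m v
      sounds : ∀ S ρ i → eval S ρ (terms i) ≡ lookup (p S ρ) i
  open DefTuple public

  abstract
    -- Finiteness of the universe makes satisfaction decidable. This justifies the classical steps
    -- below, such as expressing an implication by negation and disjunction.
    dec : ∀ {r v} {P : Pred v} → Def r P → ∀ S ρ → Dec (P S ρ)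
    dec δ S ρ = map-dec (correct δ S ρ) (sat? (structure S) (constant S) (formula δ) (lookup ρ))

  headT : ∀ {v} → DefTerm {suc v} (λ S ρ → head ρ)
  headT = record { term = var zero ; sound = λ { S (x ∷ ρ) → refl } }

  wkT : ∀ {v} {t : ∀ S → Vec (Elem S) v → Elem S} → DefTerm t → DefTerm (λ S ρ → t S (tail ρ))
  wkT τ = record { term = weakenₜ (term τ) ; sound = λ { S (x ∷ ρ) → trans (weaken-eval S x ρ (term τ)) (sound τ S ρ) } }
    where
    weaken-eval : ∀ {v} S x ρ (t : Term m v) → eval S (x ∷ ρ) (weakenₜ t) ≡ eval S ρ t
    weaken-eval S x ρ (var i) = refl
    weaken-eval S x ρ (con l) = refl

  conT : ∀ {v} l → DefTerm {v} (λ S ρ → constant S l)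
  conT l = record { term = con l ; sound = λ S ρ → refl }

  lookupT : ∀ {u v} {p : ∀ S → Vec (Elem S) v → Vec (Elem S) u} → DefTuple p → ∀ i →
    DefTerm (λ S ρ → lookup (p S ρ) i)
  lookupT τ i = record { term = terms τ i ; sound = λ S ρ → sounds τ S ρ i }

  tupleT : ∀ {u v} {p : ∀ S → Vec (Elem S) v → Vec (Elem S) u} →
    (∀ i → DefTerm (λ S ρ → lookup (p S ρ) i)) → DefTuple p
  tupleT τ = record { terms = λ i → term (τ i) ; sounds = λ S ρ i → sound (τ i) S ρ }

  idP : ∀ {v} → DefTuple {v} (λ S ρ → ρ)
  idP = record { terms = var ; sounds = λ S ρ i → refl }

  wkP : ∀ {u v} {p : ∀ S → Vec (Elem S) v → Vec (Elem S) u} → DefTuple p → DefTuple (λ S ρ → p S (tail ρ))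
  wkP τ = tupleT λ i → wkT (lookupT τ i)

  nilP : ∀ {v} → DefTuple {0} {v} (λ S ρ → [])
  nilP = tupleT λ ()

  infixr 5 _∷P_
  _∷P_ : ∀ {u v} {t : ∀ S → Vec (Elem S) v → Elem S} {p : ∀ S → Vec (Elem S) v → Vec (Elem S) u} →
    DefTerm t → DefTuple p → DefTuple (λ S ρ → t S ρ ∷ p S ρ)
  τ ∷P τs = tupleT λ { zero → τ ; (suc i) → lookupT τs i }

  takeP : ∀ d {v} → DefTuple {d} {d + v} (λ S ρ → take d ρ)
  takeP d {v} = record { terms = λ i → var (i ↑ˡ v) ; sounds = λ S ρ i → lookup-take d ρ i }

  dropT : ∀ d {v} {t : ∀ S → Vec (Elem S) v → Elem S} → DefTerm t → DefTerm {d + v} (λ S ρ → t S (drop d ρ))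
  dropT d τ = record { term = shift (term τ) ; sound = λ S ρ → trans (shift-eval S ρ (term τ)) (sound τ S (drop d ρ)) }
    where
    shift : ∀ {v} → Term m v → Term m (d + v)
    shift (var i) = var (d ↑ʳ i)
    shift (con l) = con l
    shift-eval : ∀ {v} S (ρ : Vec (Elem S) (d + v)) t → eval S ρ (shift t) ≡ eval S (drop d ρ) t
    shift-eval S ρ (var i) = lookup-drop d ρ i
    shift-eval S ρ (con l) = refl

  dropP : ∀ d {u v} {p : ∀ S → Vec (Elem S) v → Vec (Elem S) u} → DefTuple p → DefTuple {u} {d + v} (λ S ρ → p S (drop d ρ))
  dropP d τ = tupleT λ i → dropT d (lookupT τ i)

  selectP : ∀ {u v i} {p : ∀ S → Vec (Elem S) v → Vec (Elem S) u} → DefTuple p → (g : Vec (Fin u) i) →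
    DefTuple (λ S ρ → map (lookup (p S ρ)) g)
  selectP τ g = record
    { terms  = λ j → terms τ (lookup g j)
    ; sounds = λ S ρ j → trans (sounds τ S ρ (lookup g j)) (sym (lookup-map j _ g)) }

  substD : ∀ {r u v} {Q : Pred u} {p : ∀ S → Vec (Elem S) v → Vec (Elem S) u} →
    Def r Q → DefTuple p → Def r (λ S ρ → Q S (p S ρ))
  substD δ τ = record
    { formula = substitute (terms τ) (formula δ)
    ; rank≤   = ≤-trans (≤-reflexive (qr-substitute (terms τ) (formula δ))) (rank≤ δ)
    ; correct = λ S ρ → ⇔-trans
        (sat-substitute (structure S) (constant S) (sounds τ S ρ) (formula δ))
        (correct δ S _) }

  liftD : ∀ {r r′ v} {P : Pred v} → r ≤ r′ → Def r P → Def r′ P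
  liftD r≤ δ = record { formula = formula δ ; rank≤ = ≤-trans (rank≤ δ) r≤ ; correct = correct δ }

  mapD : ∀ {r v} {P Q : Pred v} → (∀ S ρ → P S ρ ⇔ Q S ρ) → Def r P → Def r Q
  mapD e δ = record { formula = formula δ ; rank≤ = rank≤ δ ; correct = λ S ρ → ⇔-trans (correct δ S ρ) (e S ρ) }

  module _ {r v : ℕ} where

    ⊤D : Def r {v} (λ S ρ → ⊤)
    -- There is at least one constant, so a true sentence exists without quantifiers even where no
    -- variable is in scope.
    ⊤D = record { formula = con zero ≐ con zero ; rank≤ = z≤n ; correct = λ S ρ → mk⇔ (λ _ → tt) (λ _ → refl) }

    infixr 6 _∧D_
    infixr 5 _∨D_
    infixr 4 _⇒D_

    _∧D_ : {P Q : Pred v} → Def r P → Def r Q → Def r (λ S ρ → P S ρ × Q S ρ)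
    δ ∧D η = record { formula = formula δ ∧' formula η ; rank≤ = ⊔-lub (rank≤ δ) (rank≤ η)
                    ; correct = λ S ρ → correct δ S ρ ×-⇔ correct η S ρ }

    _∨D_ : {P Q : Pred v} → Def r P → Def r Q → Def r (λ S ρ → P S ρ ⊎ Q S ρ)
    δ ∨D η = record { formula = formula δ ∨' formula η ; rank≤ = ⊔-lub (rank≤ δ) (rank≤ η)
                    ; correct = λ S ρ → correct δ S ρ ⊎-⇔ correct η S ρ }

    ¬D : {P : Pred v} → Def r P → Def r (λ S ρ → ¬ P S ρ)
    ¬D δ = record { formula = ¬' (formula δ) ; rank≤ = rank≤ δ ; correct = λ S ρ → ¬-⇔ (correct δ S ρ) }

    _⇒D_ : {P Q : Pred v} → Def r P → Def r Q → Def r (λ S ρ → P S ρ → Q S ρ)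
    _⇒D_ {P} {Q} δ η = mapD (λ S ρ → mk⇔ implies (material S ρ)) (¬D δ ∨D η)
      where
      implies : ∀ {X Y : Set} → ¬ X ⊎ Y → X → Y
      implies (inj₁ ¬x) x = contradiction x ¬x
      implies (inj₂ y)  x = y
      material : ∀ S ρ → (P S ρ → Q S ρ) → ¬ P S ρ ⊎ Q S ρ
      material S ρ f with dec δ S ρ
      ... | yes p = inj₂ (f p)
      ... | no ¬p = inj₁ ¬p

    _⇔D_ : {P Q : Pred v} → Def r P → Def r Q → Def r (λ S ρ → P S ρ ⇔ Q S ρ)
    δ ⇔D η = mapD (λ S ρ → mk⇔ (λ (f , g) → mk⇔ f g) (λ e → to e , from e)) ((δ ⇒D η) ∧D (η ⇒D δ))

    decD : {X : Set} → Dec X → Def r (λ S ρ → X)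
    decD (yes x) = mapD (λ S ρ → mk⇔ (λ _ → x) _) ⊤D
    decD (no ¬x) = mapD (λ S ρ → mk⇔ (λ ¬t → contradiction tt ¬t) (λ x → contradiction x ¬x)) (¬D ⊤D)

    ∃D : {P : ∀ S → Vec (Elem S) v → Elem S → Set} → Def r {suc v} (λ S ρ → P S (tail ρ) (head ρ)) →
      Def (suc r) (λ S ρ → Σ (Elem S) (P S ρ))
    ∃D δ = record { formula = ∃' (formula δ) ; rank≤ = s≤s (rank≤ δ)
                  ; correct = λ S ρ → Σ-⇔ λ a → ⇔-trans (sat-ext _ _ (λ { zero → refl ; (suc i) → refl }) (formula δ)) (correct δ S (a ∷ ρ)) }

    ∀D : {P : ∀ S → Vec (Elem S) v → Elem S → Set} → Def r {suc v} (λ S ρ → P S (tail ρ) (head ρ)) →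
      Def (suc r) (λ S ρ → ∀ a → P S ρ a)
    ∀D δ = record { formula = ∀' (formula δ) ; rank≤ = s≤s (rank≤ δ)
                  ; correct = λ S ρ → Π-⇔ λ a → ⇔-trans (sat-ext _ _ (λ { zero → refl ; (suc i) → refl }) (formula δ)) (correct δ S (a ∷ ρ)) }

    -- The index `r` is unchanged however large `n` is; this is where dependence on `k` can be
    -- hidden.
    ⋀D : ∀ {n} {P : Fin n → Pred v} → (∀ i → Def r (P i)) → Def r (λ S ρ → ∀ i → P i S ρ)
    ⋀D {zero}  δ = mapD (λ S ρ → mk⇔ (λ _ ()) _) ⊤D
    ⋀D {suc n} δ = mapD (λ S ρ → mk⇔ (λ { (p , ps) zero → p ; (p , ps) (suc i) → ps i }) (λ ps → ps zero , λ i → ps (suc i)))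
                     (δ zero ∧D ⋀D (λ i → δ (suc i)))

    ⋁D : ∀ {n} {P : Fin n → Pred v} → (∀ i → Def r (P i)) → Def r (λ S ρ → ∃ λ i → P i S ρ)
    ⋁D {zero}  δ = mapD (λ S ρ → mk⇔ (λ ¬t → contradiction tt ¬t) λ ()) (¬D ⊤D)
    ⋁D {suc n} δ = mapD (λ S ρ → mk⇔ (λ { (inj₁ p) → zero , p ; (inj₂ (i , p)) → suc i , p })
                                     (λ { (zero , p) → inj₁ p ; (suc i , p) → inj₂ (i , p) }))
                     (δ zero ∨D ⋁D (λ i → δ (suc i)))

    ⋁ᵥD : ∀ {n i} {P : Vec (Fin n) i → Pred v} → (∀ g → Def r (P g)) → Def r (λ S ρ → ∃ λ g → P g S ρ)
    ⋁ᵥD {i = zero}  δ = mapD (λ S ρ → mk⇔ (λ p → [] , p) λ { ([] , p) → p }) (δ [])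
    ⋁ᵥD {i = suc i} δ = mapD (λ S ρ → mk⇔ (λ (j , g , p) → j ∷ g , p) λ { (j ∷ g , p) → j , g , p })
                          (⋁D λ j → ⋁ᵥD λ g → δ (j ∷ g))

    module _ {t₁ : ∀ S → Vec (Elem S) v → Elem S} (τ₁ : DefTerm t₁) where

      E₀D : Def r (λ S ρ → T (E₀ (structure S) (t₁ S ρ)))
      E₀D = record { formula = E₀' (term τ₁) ; rank≤ = z≤n
                   ; correct = λ S ρ → ≡⇒⇔ (cong (T ∘ E₀ (structure S)) (sound τ₁ S ρ)) }

      module _ {t₂ : ∀ S → Vec (Elem S) v → Elem S} (τ₂ : DefTerm t₂) where

        ≡D : Def r (λ S ρ → t₁ S ρ ≡ t₂ S ρ)
        ≡D = record { formula = term τ₁ ≐ term τ₂ ; rank≤ = z≤n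
                    ; correct = λ S ρ → ≡⇒⇔ (cong₂ _≡_ (sound τ₁ S ρ) (sound τ₂ S ρ)) }

        εD : Def r (λ S ρ → T (ε (structure S) (t₁ S ρ) (t₂ S ρ)))
        εD = record { formula = ε' (term τ₁) (term τ₂) ; rank≤ = z≤n
                    ; correct = λ S ρ → ≡⇒⇔ (cong₂ (λ a b → T (ε (structure S) a b)) (sound τ₁ S ρ) (sound τ₂ S ρ)) }

        <D : Def r (λ S ρ → num S (t₁ S ρ) < num S (t₂ S ρ))
        <D = record { formula = lt' (term τ₁) (term τ₂) ; rank≤ = z≤n
                    ; correct = λ S ρ → ⇔-trans
                        (≡⇒⇔ (cong T (trans (cong₂ (lt (structure S)) (sound τ₁ S ρ) (sound τ₂ S ρ)) (presLt (iso S) _ _))))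
                        (mk⇔ (<ᵇ⇒< _ _) <⇒<ᵇ) }

        module _ {t₃ : ∀ S → Vec (Elem S) v → Elem S} (τ₃ : DefTerm t₃) where

          +D : Def r (λ S ρ → num S (t₁ S ρ) ≡ num S (t₂ S ρ) + num S (t₃ S ρ))
          +D = record { formula = add' (term τ₂) (term τ₃) (term τ₁) ; rank≤ = z≤n
                      ; correct = λ S ρ → ⇔-trans (≡⇒⇔ (cong T (equation S ρ))) (mk⇔ (≡ᵇ⇒≡ _ _) (≡⇒≡ᵇ _ _)) }
            where
            equation : ∀ S ρ → add (structure S) (eval S ρ (term τ₂)) (eval S ρ (term τ₃)) (eval S ρ (term τ₁))
                             ≡ natAdd (Inverse.to (π (iso S)) (t₂ S ρ)) (Inverse.to (π (iso S)) (t₃ S ρ)) (Inverse.to (π (iso S)) (t₁ S ρ))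
            equation S ρ = trans (cong₃ (add (structure S)) (sound τ₂ S ρ) (sound τ₃ S ρ) (sound τ₁ S ρ)) (presAdd (iso S) _ _ _)

          *D : Def r (λ S ρ → num S (t₁ S ρ) ≡ num S (t₂ S ρ) * num S (t₃ S ρ))
          *D = record { formula = mul' (term τ₂) (term τ₃) (term τ₁) ; rank≤ = z≤n
                      ; correct = λ S ρ → ⇔-trans (≡⇒⇔ (cong T (equation S ρ))) (mk⇔ (≡ᵇ⇒≡ _ _) (≡⇒≡ᵇ _ _)) }
            where
            equation : ∀ S ρ → mul (structure S) (eval S ρ (term τ₂)) (eval S ρ (term τ₃)) (eval S ρ (term τ₁))
                             ≡ natMul (Inverse.to (π (iso S)) (t₂ S ρ)) (Inverse.to (π (iso S)) (t₃ S ρ)) (Inverse.to (π (iso S)) (t₁ S ρ))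
            equation S ρ = trans (cong₃ (mul (structure S)) (sound τ₂ S ρ) (sound τ₃ S ρ) (sound τ₁ S ρ)) (presMul (iso S) _ _ _)

  ∃++D : ∀ {r v} d {P : Pred (d + v)} → Def r P → Def (d + r) {v} (λ S ρ → Σ (Vec (Elem S) d) λ z → P S (z ++ ρ))
  ∃++D zero    δ = mapD (λ S ρ → mk⇔ (λ p → [] , p) λ { ([] , p) → p }) δ
  ∃++D {r} {v} (suc d) {P} δ = liftD (≤-reflexive (+-suc d r))
    (mapD (λ S ρ → mk⇔ (λ (z , a , p) → a ∷ z , p) λ { (a ∷ z , p) → z , a , p })
      (∃++D d (∃D (mapD (λ { S (a ∷ ρ) → ⇔-refl }) δ))))

  ∃*D : ∀ {r v} d {P : ∀ S → Vec (Elem S) v → Vec (Elem S) d → Set} →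
    Def r {d + v} (λ S ρ → P S (drop d ρ) (take d ρ)) → Def (d + r) (λ S ρ → Σ (Vec (Elem S) d) (P S ρ))
  ∃*D d {P} δ = mapD (λ S ρ → Σ-⇔ λ z → ≡⇒⇔ (cong₂ (P S) (drop-++ z ρ) (take-++ z ρ))) (∃++D d δ)

  ∀*D : ∀ {r v} d {P : ∀ S → Vec (Elem S) v → Vec (Elem S) d → Set} →
    Def r {d + v} (λ S ρ → P S (drop d ρ) (take d ρ)) → Def (d + r) (λ S ρ → ∀ z → P S ρ z)
  ∀*D d {P} δ = mapD (λ S ρ → mk⇔ (stable S ρ) λ f (z , ¬p) → ¬p (f z)) (¬D (∃*D d (¬D δ)))
    where
    stable : ∀ S ρ → ¬ (∃ λ z → ¬ P S ρ z) → ∀ z → P S ρ z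
    stable S ρ ¬∃ z with dec δ S (z ++ ρ)
    ... | yes p = subst₂ (P S) (drop-++ z ρ) (take-++ z ρ) p
    ... | no ¬p = contradiction (z , λ p → ¬p (subst₂ (P S) (sym (drop-++ z ρ)) (sym (take-++ z ρ)) p)) ¬∃

  ∈D : ∀ {r u v} {t : ∀ S → Vec (Elem S) v → Elem S} {p : ∀ S → Vec (Elem S) v → Vec (Elem S) u} →
    DefTerm t → DefTuple p → Def r (λ S ρ → t S ρ ∈ᵥ p S ρ)
  ∈D τ τs = ⋁D λ i → ≡D (lookupT τs i) τ

  -- Since multiplication is a relation, the product of quotient and divisor needs a quantifier of
  -- its own. Both witnesses are at most x and therefore exist in the universe.
  Residue : (S : Arithmetical) → (x d y : Elem S) → Set
  Residue S x d y = num S y < num S d ×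
    Σ (Elem S) λ q → Σ (Elem S) λ z → num S z ≡ num S q * num S d × num S x ≡ num S z + num S y

  residueD : ∀ {r v} {x d y : ∀ S → Vec (Elem S) v → Elem S} → DefTerm x → DefTerm d → DefTerm y →
    Def (2 + r) (λ S ρ → Residue S (x S ρ) (d S ρ) (y S ρ))
  residueD x d y = <D y d ∧D ∃D (∃D (*D headT (wkT headT) (wkT (wkT d)) ∧D +D (wkT (wkT x)) headT (wkT (wkT y))))

-- Counting by colouring

AtLeast : ∀ {X : Set} → ℕ → (X → Set) → Set
AtLeast {X} n P = Σ (Fin n → X) λ x → Injective _≡_ _≡_ x × (∀ i → P (x i))

module Counting (m-1 : ℕ) where
  open Definability m-1

  residue-% : ∀ S x d y d-1 → num S d ≡ suc d-1 → Residue S x d y ⇔ (num S y ≡ num S x % suc d-1)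
  residue-% S x d y d-1 d≡ rewrite d≡ = mk⇔ remainder division
    where
    open ≡-Reasoning
    remainder : _ → num S y ≡ num S x % suc d-1
    remainder (y< , q , z , z≡ , x≡) = sym (begin
      num S x % suc d-1                        ≡⟨ cong (_% suc d-1) x≡ ⟩
      (num S z + num S y) % suc d-1            ≡⟨ cong (_% suc d-1) (+-comm (num S z) (num S y)) ⟩
      (num S y + num S z) % suc d-1            ≡⟨ cong (λ ◌ → (num S y + ◌) % suc d-1) z≡ ⟩
      (num S y + num S q * suc d-1) % suc d-1  ≡⟨ [m+kn]%n≡m%n (num S y) (num S q) (suc d-1) ⟩
      num S y % suc d-1                        ≡⟨ m<n⇒m%n≡m y< ⟩
      num S y                                  ∎)
    division : num S y ≡ num S x % suc d-1 → _
    division y≡ =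
      subst (_< suc d-1) (sym y≡) (m%n<n (num S x) (suc d-1)) ,
      element S (num S x / suc d-1) q< , element S (num S x / suc d-1 * suc d-1) z< ,
      trans (num-element S _ z<) (cong (_* suc d-1) (sym (num-element S _ q<))) ,
      (begin
        num S x                                             ≡⟨ m≡m%n+[m/n]*n (num S x) (suc d-1) ⟩
        num S x % suc d-1 + num S x / suc d-1 * suc d-1     ≡⟨ +-comm (num S x % suc d-1) _ ⟩
        num S x / suc d-1 * suc d-1 + num S x % suc d-1     ≡⟨ cong₂ _+_ (sym (num-element S _ z<)) (sym y≡) ⟩
        num S (element S (num S x / suc d-1 * suc d-1) z<) + num S y ∎)
      where
      q< = ≤-<-trans (m/n≤m (num S x) (suc d-1)) (num< S x)
      z< = ≤-<-trans (m/n*n≤m (num S x) (suc d-1)) (num< S x)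

  module Colours (T : ℕ) (threshold≤m : Hashing.threshold T ≤ m) where
    open Hashing T

    -- A listed colouring is for structures with at most m elements, which are all named by constants.
    data Colouring : Set where
      hashed : Colouring
      listed : Vec (Fin m) T → Colouring

    multiplier<m : (l : Fin T) → codeMultiplier (toℕ l) < m
    multiplier<m l = ≤-trans (s≤s (+-monoʳ-≤ separators (toℕ<n l)))
      (≤-trans (<⇒≤ indices<threshold) threshold≤m)

    1<m : 1 < m
    1<m = ≤-trans (≤-trans (s≤s (s≤s z≤n)) indices<threshold) threshold≤m

    multiplier : Fin T → Fin m
    multiplier l = fromℕ< (multiplier<m l)

    one : Fin m
    one = fromℕ< 1<m

    IsModulus : (S : Arithmetical) → Fin T → (b u : Elem S) → Set
    IsModulus S l b u = Σ (Elem S) λ t →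
      num S t ≡ num S (constant S (multiplier l)) * num S b × num S u ≡ num S t + num S (constant S one)

    HasColour : Colouring → (S : Arithmetical) → (b c d : Elem S) → Fin T → Elem S → Set
    HasColour hashed     S b c d l x = Σ (Elem S) λ y → Residue S x d y ×
      Σ (Elem S) λ u → IsModulus S l b u × Residue S c u y
    HasColour (listed t) S b c d l x = x ≡ constant S (lookup t l)

    hasColourD : ∀ κ {r v l} {b c d x : ∀ S → Vec (Elem S) v → Elem S} →
      DefTerm b → DefTerm c → DefTerm d → DefTerm x →
      Def (4 + r) (λ S ρ → HasColour κ S (b S ρ) (c S ρ) (d S ρ) l (x S ρ))
    hasColourD hashed {l = l} b c d x = ∃D (
      residueD (wkT x) (wkT d) headT ∧D
      ∃D (∃D (*D headT (conT (multiplier l)) (wkT (wkT (wkT b))) ∧D +D (wkT headT) headT (conT one)) ∧D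
          residueD (wkT (wkT c)) headT (wkT headT)))
    hasColourD (listed t) {l = l} b c d x = ≡D x (conT (lookup t l))

    ⋁κD : ∀ {r v} {P : Colouring → Pred v} → (∀ κ → Def r (P κ)) → Def r (λ S ρ → ∃ λ κ → P κ S ρ)
    ⋁κD δ = mapD (λ S ρ → mk⇔ (λ { (inj₁ p) → hashed , p ; (inj₂ (t , p)) → listed t , p })
                              (λ { (hashed , p) → inj₁ p ; (listed t , p) → inj₂ (t , p) }))
              (δ hashed ∨D ⋁ᵥD λ t → δ (listed t))

    -- Exactness is demanded on the listed elements only. All other elements may have any colours,
    -- as hashing gives no control over them.
    Rainbow : (S : Arithmetical) → (Fin T → Elem S) → Set
    Rainbow S x = ∃ λ κ → Σ (Elem S) λ b → Σ (Elem S) λ c → Σ (Elem S) λ d →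
      ∀ l i → HasColour κ S b c d l (x i) ⇔ (l ≡ i)

    rainbow-hashed : ∀ S → m ≤ suc (size-1 S) → (x : Fin T → Elem S) →
      Hash (suc (size-1 S)) (λ i → num S (x i)) → Rainbow S x
    rainbow-hashed S m≤N x hashing = hashed , b , c , d , λ l i → mk⇔
      (λ { (y , x≡y , u , u-modulus , c≡y) → to (separates l i)
             (trans (sym (to (residue-% S (x i) d y modulus-1 num-d) x≡y))
                    (to (residue-% S c u y _ (is-modulus l u u-modulus)) c≡y ■ cong (_% modulus base (toℕ l)) num-c)) })
      (λ l≡i → let y< = ≤-<-trans (m%n≤m (num S (x i)) (suc modulus-1)) (num< S (x i))
                   y  = element S (num S (x i) % suc modulus-1) y<
                   y≡ = num-element S _ y<
                   u  = element S (modulus base (toℕ l)) (modulus<N l)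
                   u≡ = num-element S _ (modulus<N l)
               in  y , from (residue-% S (x i) d y modulus-1 num-d) y≡ ,
                   u , modulus-is l u u≡ ,
                   from (residue-% S c u y _ u≡) (y≡ ■ from (separates l i) l≡i ■ cong (_% modulus base (toℕ l)) (sym num-c)))
      where
      infixr 5 _■_
      _■_ : ∀ {X : Set} {x y z : X} → x ≡ y → y ≡ z → x ≡ z
      _■_ = trans
      open Hash hashing
      b = element S base base<N
      c = element S code code<N
      d = element S (suc modulus-1) modulus-1<N
      num-b = num-element S base base<N
      num-c = num-element S code code<N
      num-d = num-element S (suc modulus-1) modulus-1<N
      num-con : ∀ {i} (i<m : i < m) → num S (constant S (fromℕ< i<m)) ≡ i
      num-con i<m = num-constant S (fromℕ< i<m) (s≤s⁻¹ (≤-trans (toℕ<n (fromℕ< i<m)) m≤N)) ■ toℕ-fromℕ< i<m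
      num-multiple : ∀ l → num S (constant S (multiplier l)) * num S b ≡ codeMultiplier (toℕ l) * base
      num-multiple l = cong₂ _*_ (num-con (multiplier<m l)) num-b
      is-modulus : ∀ l u → IsModulus S l b u → num S u ≡ modulus base (toℕ l)
      is-modulus l u (t , t≡ , u≡) = u≡ ■ cong₂ _+_ (t≡ ■ num-multiple l) (num-con 1<m) ■ +-comm _ 1
      modulus-is : ∀ l u → num S u ≡ modulus base (toℕ l) → IsModulus S l b u
      modulus-is l u u≡ = element S _ t< , num-element S _ t< ■ sym (num-multiple l) ,
        u≡ ■ +-comm 1 _ ■ cong₂ _+_ (sym (num-element S _ t<)) (sym (num-con 1<m))
        where t< = <-trans (n<1+n _) (modulus<N l)

    rainbow-listed : ∀ S → suc (size-1 S) ≤ m → (x : Fin T → Elem S) → Injective _≡_ _≡_ x → Rainbow S x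
    rainbow-listed S N≤m x x-injective = listed (tabulate name) , x₀ , x₀ , x₀ , λ l i → mk⇔
      (λ eq → sym (x-injective (trans eq (named l))))
      (λ { refl → sym (named l) })
      where
      x₀ : Elem S
      x₀ = zero
      name< : ∀ l → num S (x l) < m
      name< l = <-≤-trans (num< S (x l)) N≤m
      name : Fin T → Fin m
      name l = fromℕ< (name< l)
      named : ∀ l → constant S (lookup (tabulate name) l) ≡ x l
      named l rewrite lookup∘tabulate name l = num-injective S
        (trans (num-constant S (name l) (subst (_≤ size-1 S) (sym (toℕ-fromℕ< (name< l))) (s≤s⁻¹ (num< S (x l)))))
               (toℕ-fromℕ< (name< l)))

    abstract
      rainbow : ∀ S → (x : Fin T → Elem S) → Injective _≡_ _≡_ x → Rainbow S x
      -- If m ≤ N, then no constant is clamped and N is at least the threshold; if N ≤ m, every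
      -- element is the value of a constant.
      rainbow S x x-injective with ≤-total m (suc (size-1 S))
      ... | inj₁ m≤N = rainbow-hashed S m≤N x (hash (≤-trans threshold≤m m≤N) (λ i → num S (x i))
                         (λ eq → x-injective (num-injective S eq)) (λ i → num< S (x i)))
      ... | inj₂ N≤m = rainbow-listed S N≤m x x-injective

    -- After b, c, d each witness is quantified in its own conjunct. Distinctness is not stated but
    -- follows: the witness for l has colour l and no other of the T colours. Hence b, c, d need no
    -- verification for soundness, while `rainbow` supplies them for completeness. The rank is 3 for
    -- b, c, d, 1 for the witness and at most 4 + r for its properties.
    atLeastD : ∀ {r v} (P : ∀ S → Vec (Elem S) v → Elem S → Set) →
      Def r {suc v} (λ S ρ → P S (tail ρ) (head ρ)) → Def (8 + r) (λ S ρ → AtLeast T (P S ρ))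
    atLeastD {r} {v} P δ = mapD (λ S ρ → mk⇔ (select S ρ) (colour S ρ)) (
      ⋁κD λ κ → ∃D (∃D (∃D (⋀D λ l → ∃D (
        liftD (m≤n+m r 4) (substD δ (headT ∷P wkP (wkP (wkP (wkP idP))))) ∧D
        ⋀D λ l′ → hasColourD κ (wkT (wkT (wkT headT))) (wkT (wkT headT)) (wkT headT) headT ⇔D decD (l′ ≟ l))))))
      where
      Coloured : ∀ S → Vec (Elem S) v → Set
      Coloured S ρ = ∃ λ κ → Σ (Elem S) λ b → Σ (Elem S) λ c → Σ (Elem S) λ d →
        ∀ l → Σ (Elem S) λ x → P S ρ x × (∀ l′ → HasColour κ S b c d l′ x ⇔ (l′ ≡ l))
      select : ∀ S ρ → Coloured S ρ → AtLeast T (P S ρ)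
      select S ρ (κ , b , c , d , f) = (λ l → proj₁ (f l)) ,
        (λ {l} {l′} eq → to (proj₂ (proj₂ (f l′)) l)
          (subst (HasColour κ S b c d l) eq (from (proj₂ (proj₂ (f l)) l) refl))) ,
        (λ l → proj₁ (proj₂ (f l)))
      colour : ∀ S ρ → AtLeast T (P S ρ) → Coloured S ρ
      colour S ρ (x , x-injective , p) with κ , b , c , d , e ← rainbow S x x-injective =
        κ , b , c , d , λ l → x l , p l , λ l′ → e l′ l

-- The combinatorics of the kernel

injective-into-list : ∀ {X : Set} {n} {x : Fin n → X} {L} → Injective _≡_ _≡_ x → (∀ i → x i ∈ L) → n ≤ length L
injective-into-list {L = L} x-injective x∈L = injective⇒≤ {f = λ i → index (x∈L i)} λ {i} {j} eq →
  x-injective (trans (lookup-index (x∈L i)) (trans (cong (lookupₗ L) eq) (sym (lookup-index (x∈L j)))))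

unique⇒lookup-injective : ∀ {X : Set} {L : List X} → Unique L → Injective _≡_ _≡_ (lookupₗ L)
unique⇒lookup-injective (x∉ ∷ u) {zero}  {zero}  eq = refl
unique⇒lookup-injective {L = x ∷ L} (x∉ ∷ u) {zero}  {suc j} eq = contradiction eq (All.lookup x∉ (∈-lookup j))
unique⇒lookup-injective {L = x ∷ L} (x∉ ∷ u) {suc i} {zero}  eq = contradiction (sym eq) (All.lookup x∉ (∈-lookup i))
unique⇒lookup-injective (x∉ ∷ u) {suc i} {suc j} eq = cong suc (unique⇒lookup-injective u eq)

module _ {N : ℕ} {P : Fin N → Set} (P? : Decidable P) where

  select : List (Fin N)
  select = filter P? (allFin N)

  ∈-select : ∀ {y} → P y → y ∈ select
  ∈-select {y} p = ∈-filter⁺ P? (∈-allFin y) p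

  select-∈ : ∀ {y} → y ∈ select → P y
  select-∈ y∈ = proj₂ (∈-filter⁻ P? {xs = allFin N} y∈)

  select-unique : Unique select
  select-unique = filter⁺ P? (allFin⁺ N)

atLeast-select : ∀ {N} {P : Fin N → Set} (P? : Decidable P) → AtLeast (length (select P?)) P
atLeast-select P? = lookupₗ (select P?) , unique⇒lookup-injective (select-unique P?) , λ i → select-∈ P? (∈-lookup i)

atLeast-≤ : ∀ {X : Set} (P : X → Set) {m n} → m ≤ n → AtLeast n P → AtLeast m P
atLeast-≤ P m≤n (x , x-injective , p) =
  (λ i → x (inject≤ i m≤n)) , (λ eq → inject≤-injective m≤n m≤n _ _ (x-injective eq)) , (λ i → p (inject≤ i m≤n))

¬atLeast⇒select< : ∀ {N} {P : Fin N → Set} (P? : Decidable P) {n} → ¬ AtLeast n P → length (select P?) < n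
¬atLeast⇒select< {P = P} P? ¬many = ≰⇒> λ n≤ → ¬many (atLeast-≤ P n≤ (atLeast-select P?))

length-concatMap : ∀ {X Y : Set} {n} (f : X → List Y) L →
  (∀ {x} → x ∈ L → length (f x) ≤ n) → length (concatMap f L) ≤ length L * n
length-concatMap f []      f≤ = z≤n
length-concatMap f (x ∷ L) f≤ = ≤-trans (≤-reflexive (length-++ (f x)))
  (+-mono-≤ (f≤ (here refl)) (length-concatMap f L λ x∈ → f≤ (there x∈)))

infix 4 _⊆ᵥ_
_⊆ᵥ_ : ∀ {X : Set} {i j} → Vec X i → Vec X j → Set
x ⊆ᵥ z = ∀ j → lookup x j ∈ᵥ z

Distinct : ∀ {X : Set} {i} → Vec X i → Set
Distinct x = ∀ i j → lookup x i ≡ lookup x j → i ≡ j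

∈ᵥ-⊆ᵥ : ∀ {X : Set} {i j} (x : Vec X i) (z : Vec X j) {y} → y ∈ᵥ x → x ⊆ᵥ z → y ∈ᵥ z
∈ᵥ-⊆ᵥ x z (i , refl) x⊆z = x⊆z i

distinct-⊆ : ∀ {X : Set} {i j} (x : Vec X i) (z : Vec X j) → Distinct x → x ⊆ᵥ z → i ≤ j
distinct-⊆ x z distinct x⊆z = injective⇒≤ {f = λ l → proj₁ (x⊆z l)} λ {l} {l′} eq →
  distinct l l′ (trans (sym (proj₂ (x⊆z l))) (trans (cong (lookup z) eq) (proj₂ (x⊆z l′))))

distinct-∷ : ∀ {X : Set} {i} (x : Vec X i) {y} → ¬ y ∈ᵥ x → Distinct x → Distinct (y ∷ x)
distinct-∷ x y∉ distinct zero    zero    eq = refl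
distinct-∷ x y∉ distinct zero    (suc j) eq = contradiction (j , sym eq) y∉
distinct-∷ x y∉ distinct (suc i) zero    eq = contradiction (i , eq) y∉
distinct-∷ x y∉ distinct (suc i) (suc j) eq = cong suc (distinct i j eq)

⊆ᵥ-select : ∀ {X : Set} {i j} (x : Vec X i) (z : Vec X j) → x ⊆ᵥ z → ∃ λ g → map (lookup z) g ≡ x
⊆ᵥ-select []      z x⊆z = [] , refl
⊆ᵥ-select (y ∷ x) z x⊆z with g , eq ← ⊆ᵥ-select x z (λ j → x⊆z (suc j)) =
  proj₁ (x⊆z zero) ∷ g , cong₂ _∷_ (proj₂ (x⊆z zero)) eq

select-⊆ᵥ : ∀ {X : Set} {i j} (z : Vec X j) (g : Vec (Fin j) i) → map (lookup z) g ⊆ᵥ z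
select-⊆ᵥ z g l = lookup g l , sym (lookup-map l (lookup z) g)

module _ {N : ℕ} where

  private X = Fin N

  infix 4 _∈ᵥ?_
  _∈ᵥ?_ : ∀ {i} (y : X) (x : Vec X i) → Dec (y ∈ᵥ x)
  y ∈ᵥ? x = any? λ i → lookup x i ≟ y

  -- A further entry of x′ would give i + 1 distinct elements inside an i-tuple.
  distinct-full : ∀ {i} (x x′ : Vec X i) → Distinct x → x ⊆ᵥ x′ → ∀ {y} → y ∈ᵥ x′ → y ∈ᵥ x
  distinct-full x x′ distinct x⊆x′ {y} y∈ = decidable-stable (y ∈ᵥ? x) λ y∉ →
    1+n≰n (distinct-⊆ (y ∷ x) x′ (distinct-∷ x y∉ distinct) λ { zero → y∈ ; (suc j) → x⊆x′ j })

-- A d-tuple stands for the set of its entries, repetitions being allowed.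
module Sets {N d : ℕ} where

  private X = Fin N

  Family : Set₁
  Family = Vec X d → Set

  Link : Family → ∀ {i} → Vec X i → X → Set
  Link F x y = ¬ (y ∈ᵥ x) × Σ (Vec X d) λ z → F z × x ⊆ᵥ z × y ∈ᵥ z

  -- What is counted is elements, not members of `F`: an element costs one quantifier, and the count
  -- is insensitive to different tuples listing the same set.
  Heavy : ℕ → Family → ∀ {i} → Vec X i → Set
  Heavy n F x = Distinct x × AtLeast n (Link F x)

  Light : ℕ → Family → ℕ → Set
  Light n F i = ∀ (x : Vec X i) → ¬ Heavy n F x

  -- The subset is given by its positions g in z, so that a disjunction over g replaces a
  -- quantification over i-tuples.
  HasHeavy : ℕ → Family → ℕ → Family
  HasHeavy n F i z = Σ (Vec (Fin d) i) λ g → Heavy n F (map (lookup z) g)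

  IsHeavy : ℕ → Family → ℕ → Family
  IsHeavy n F i z = Σ (Vec (Fin d) i) λ g → Heavy n F (map (lookup z) g) × z ⊆ᵥ map (lookup z) g

  Reduce : ℕ → Family → ℕ → Family
  Reduce n F i z = (F z × ¬ HasHeavy n F i z) ⊎ IsHeavy n F i z

  Hits : List X → Family → Set
  Hits H F = ∀ z → F z → ∃ λ v → v ∈ H × v ∈ᵥ z

  -- This starts the rounds: d distinct elements fill a d-tuple and leave no room for a further one.
  light-d : ∀ F → Light 1 F d
  light-d F x (distinct , y , _ , linked) with y∉x , z , _ , x⊆z , y∈z ← linked zero =
    y∉x (distinct-full x z distinct x⊆z y∈z)

  module _ {F : Family} (link? : ∀ {i} (x : Vec X i) → Decidable (Link F x)) where

    -- Every y linked to x lies in a member of F met outside x by some h ∈ H, so that y is h or is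
    -- linked to h ∷ x.
    heavy-hit : ∀ {i k n H} → Light n F (suc i) → Hits H F → length H ≤ k →
      (x : Vec X i) → Heavy (suc (suc k * n)) F x → ∃ λ v → v ∈ H × v ∈ᵥ x
    heavy-hit {i} {k} {n} {H} light hits H≤k x (distinct , y , y-injective , linked)
      with Any.any? (_∈ᵥ? x) H
    ... | yes hit = find hit
    ... | no ¬hit = contradiction
      (≤-trans (injective-into-list y-injective λ i → covered (linked i))
        (≤-trans (length-concatMap neighbours H neighbours≤)
          (≤-trans (*-monoˡ-≤ n H≤k) (m≤n+m (k * n) n))))
      1+n≰n
      where
      neighbours : X → List X
      neighbours h = h ∷ select (link? (h ∷ x))
      neighbours≤ : ∀ {h} → h ∈ H → length (neighbours h) ≤ n
      neighbours≤ {h} h∈H = ¬atLeast⇒select< (link? (h ∷ x)) λ many →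
        light (h ∷ x) (distinct-∷ x (λ h∈x → ¬hit (lose h∈H h∈x)) distinct , many)
      covered : ∀ {y} → Link F x y → y ∈ concatMap neighbours H
      covered {y} (y∉x , z , Fz , x⊆z , y∈z) with h , h∈H , h∈z ← hits z Fz =
        ∈-concatMap⁺ neighbours (lose h∈H near)
        where
        near : y ∈ neighbours h
        near with y ≟ h
        ... | yes y≡h = here y≡h
        ... | no  y≢h = there (∈-select (link? (h ∷ x))
          ( (λ { (zero , h≡y) → y≢h (sym h≡y) ; (suc j , eq) → y∉x (j , eq) })
          , z , Fz , (λ { zero → h∈z ; (suc j) → x⊆z j }) , y∈z))

    reduce-hits : ∀ {i k n H} → Light n F (suc i) → length H ≤ k → Hits H F → Hits H (Reduce (suc (suc k * n)) F i)
    reduce-hits light H≤k hits z (inj₁ (Fz , _)) = hits z Fz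
    reduce-hits light H≤k hits z (inj₂ (g , heavy , _)) with v , v∈H , v∈x ← heavy-hit light hits H≤k (map (lookup z) g) heavy =
      v , v∈H , ∈ᵥ-⊆ᵥ (map (lookup z) g) z v∈x (select-⊆ᵥ z g)

  -- The d-tuple obtained from z by overwriting the entries outside a heavy subtuple x with the first
  -- entry of x lists exactly x.
  hits-reduce : ∀ {F n H} i → (∀ z → Dec (HasHeavy n F (suc i) z)) → Hits H (Reduce n F (suc i)) → Hits H F
  hits-reduce {F} {n} {H} i heavy? hits z Fz with heavy? z
  ... | no ¬heavy = hits z (inj₁ (Fz , ¬heavy))
  ... | yes (g , heavy) = let v , v∈H , v∈z′ = hits z′ (inj₂ (g , subst (Heavy n F) same heavy , subst (z′ ⊆ᵥ_) same z′⊆x))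
                          in  v , v∈H , ∈ᵥ-⊆ᵥ x z (∈ᵥ-⊆ᵥ z′ x v∈z′ z′⊆x) (select-⊆ᵥ z g)
    where
    x = map (lookup z) g
    entry : Fin d → X
    entry l with lookup z l ∈ᵥ? x
    ... | yes _ = lookup z l
    ... | no  _ = lookup x zero
    z′ = tabulate entry
    entry∈x : ∀ l → entry l ∈ᵥ x
    entry∈x l with lookup z l ∈ᵥ? x
    ... | yes z∈x = z∈x
    ... | no  _   = zero , refl
    z′⊆x : z′ ⊆ᵥ x
    z′⊆x l = subst (_∈ᵥ x) (sym (lookup∘tabulate entry l)) (entry∈x l)
    kept : ∀ l → lookup z l ∈ᵥ x → entry l ≡ lookup z l
    kept l z∈x with lookup z l ∈ᵥ? x
    ... | yes _   = refl
    ... | no  z∉x = contradiction z∈x z∉x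
    same : x ≡ map (lookup z′) g
    same = begin
      x                                           ≡⟨ tabulate∘lookup x ⟨
      tabulate (lookup x)                         ≡⟨ tabulate-cong agrees ⟩
      tabulate (lookup (map (lookup z′) g))       ≡⟨ tabulate∘lookup _ ⟩
      map (lookup z′) g                           ∎
      where
      open ≡-Reasoning
      agrees : ∀ l → lookup x l ≡ lookup (map (lookup z′) g) l
      agrees l = begin
        lookup x l                     ≡⟨ lookup-map l (lookup z) g ⟩
        lookup z (lookup g l)          ≡⟨ kept (lookup g l) (l , lookup-map l (lookup z) g) ⟨
        entry (lookup g l)             ≡⟨ lookup∘tabulate entry (lookup g l) ⟨
        lookup z′ (lookup g l)         ≡⟨ lookup-map l (lookup z′) g ⟨
        lookup (map (lookup z′) g) l   ∎

  -- A new tuple lists a set of i elements, so if it contains x it lists x and links nothing to it.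
  -- All links therefore come from old members, whence x was heavy before; but then no old member
  -- containing x survives. The successor in `suc n` provides the one link that is needed for the
  -- contradiction.
  reduce-light : ∀ F i n → Light (suc n) (Reduce (suc n) F i) i
  reduce-light F i n x (distinct , y , y-injective , linked) =
    proj₂ (old (linked zero)) (distinct , y , y-injective , λ j → proj₁ (old (linked j)))
    where
    old : ∀ {y} → Link (Reduce (suc n) F i) x y → Link F x y × ¬ Heavy (suc n) F x
    old (y∉x , z , inj₁ (Fz , ¬heavy) , x⊆z , y∈z) = (y∉x , z , Fz , x⊆z , y∈z) , λ heavy →
      let g , eq = ⊆ᵥ-select x z x⊆z in ¬heavy (g , subst (Heavy (suc n) F) (sym eq) heavy)
    old (y∉x , z , inj₂ (g , _ , z⊆) , x⊆z , y∈z) = contradiction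
      (distinct-full x (map (lookup z) g) distinct
        (λ j → ∈ᵥ-⊆ᵥ z (map (lookup z) g) (x⊆z j) z⊆) (∈ᵥ-⊆ᵥ z (map (lookup z) g) y∈z z⊆)) y∉x

-- The kernel is definable

open Sets

-- Summing makes the bound monotone without any monotonicity of `Hashing.threshold`.
thresholds : ℕ → ℕ
thresholds zero    = Hashing.threshold 0
thresholds (suc n) = Hashing.threshold (suc n) + thresholds n

threshold≤ : ∀ {T n} → T ≤ n → Hashing.threshold T ≤ thresholds n
threshold≤ {T} {n} T≤n with m≤n⇒m<n∨m≡n T≤n
threshold≤ {n = zero}  T≤n | inj₂ refl = ≤-refl
threshold≤ {n = suc n} T≤n | inj₂ refl = m≤m+n _ _
threshold≤ {n = suc n} T≤n | inj₁ T<n  = ≤-trans (threshold≤ (s≤s⁻¹ T<n)) (m≤n+m _ _)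

Edge Vertex : (S : Arithmetical) → Elem S → Set
Edge S e = T (E₀ (structure S) e)
Vertex S v = ¬ Edge S v

Incident : (S : Arithmetical) → (v e : Elem S) → Set
Incident S v e = T (ε (structure S) v e)

HitsEdges : (S : Arithmetical) → List (Elem S) → Set
HitsEdges S H = ∀ e → Edge S e → ∃ λ v → v ∈ H × Incident S v e

-- By the last clause an edge has at most d elements and, for d ≥ 1, at least one.
IsHypergraph : ℕ → Arithmetical → Set
IsHypergraph d S =
  (∀ v e → Incident S v e → Vertex S v × Edge S e) ×
  (∀ e e′ → Edge S e → Edge S e′ → (∀ v → Incident S v e ⇔ Incident S v e′) → e ≡ e′) ×
  (∀ e → Edge S e → Σ (Vec (Elem S) d) λ z → ∀ v → Incident S v e ⇔ (v ∈ᵥ z))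

EdgeTuple : ∀ {d} → Pred d
EdgeTuple S z = Σ (Elem S) λ e → Edge S e × (∀ v → Incident S v e ⇔ (v ∈ᵥ z))

-- Where no value is allowed, f takes the junk value zero.
partial-choice : ∀ {k N} {C : Fin k → Fin (suc N) → Set} → (∀ l v → Dec (C l v)) →
  (∀ l v v′ → C l v → C l v′ → v ≡ v′) → Σ (Fin k → Fin (suc N)) λ f → ∀ l v → C l v → f l ≡ v
partial-choice {k} {N} {C} C? unique = (λ l → pick l (any? (C? l))) , λ l v → picked l v (any? (C? l))
  where
  pick : ∀ l → Dec (∃ (C l)) → Fin (suc N)
  pick l (yes (v , _)) = v
  pick l (no _)        = zero
  picked : ∀ l v (p : Dec (∃ (C l))) → C l v → pick l p ≡ v
  picked l v (yes (v′ , c′)) c = unique l v′ v c′ c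
  picked l v (no ¬c)         c = contradiction (v , c) ¬c

-- A colouring is exact only on the elements it was built for. For a colour to be unique among the
-- kernel vertices, these must all be enumerated together with the solution x. How many lie outside
-- x is unknown but bounded, and the sentence takes a disjunction over this number j.
enumerate-extending : ∀ {k N n} {x : Fin k → Fin N} {P : Fin N → Set} → Injective _≡_ _≡_ x →
  Decidable P → ¬ AtLeast n P → Σ (Fin n) λ j → Σ (Fin (k + toℕ j) → Fin N) λ y → Injective _≡_ _≡_ y ×
    (∀ l → y (l ↑ˡ toℕ j) ≡ x l) × (∀ v → P v → ∃ λ i → y i ≡ v)
enumerate-extending {k} {N} {n} {x} {P} x-injective P? few = fromℕ< rest< ,
  subst (λ j → Σ (Fin (k + j) → Fin N) λ y → Injective _≡_ _≡_ y ×
                 (∀ l → y (l ↑ˡ j) ≡ x l) × (∀ v → P v → ∃ λ i → y i ≡ v))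
        (sym (toℕ-fromℕ< rest<)) (y , y-injective , y-↑ˡ , y-covers)
  where
  Rest : Fin N → Set
  Rest v = P v × ¬ (∃ λ l → x l ≡ v)
  rest? : Decidable Rest
  rest? v = P? v ×-dec ¬? (any? λ l → x l ≟ v)
  rest = select rest?
  j = length rest
  rest< : j < n
  rest< = ¬atLeast⇒select< rest? λ (z , z-injective , z-rest) → few (z , z-injective , λ i → proj₁ (z-rest i))
  y : Fin (k + j) → Fin N
  y i = [ x , lookupₗ rest ]′ (splitAt k i)
  disjoint : ∀ l i → x l ≢ lookupₗ rest i
  disjoint l i eq = proj₂ (select-∈ rest? (∈-lookup i)) (l , eq)
  sum-injective : ∀ s s′ → [ x , lookupₗ rest ]′ s ≡ [ x , lookupₗ rest ]′ s′ → s ≡ s′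
  sum-injective (inj₁ l) (inj₁ l′) eq = cong inj₁ (x-injective eq)
  sum-injective (inj₁ l) (inj₂ i)  eq = contradiction eq (disjoint l i)
  sum-injective (inj₂ i) (inj₁ l)  eq = contradiction (sym eq) (disjoint l i)
  sum-injective (inj₂ i) (inj₂ i′) eq = cong inj₂ (unique⇒lookup-injective (select-unique rest?) eq)
  y-injective : Injective _≡_ _≡_ y
  y-injective {i} {i′} eq = trans (sym (join-splitAt k j i))
    (trans (cong (join k j) (sum-injective (splitAt k i) (splitAt k i′) eq)) (join-splitAt k j i′))
  y-↑ˡ : ∀ l → y (l ↑ˡ j) ≡ x l
  y-↑ˡ l = cong [ x , lookupₗ rest ]′ (splitAt-↑ˡ k l j)
  y-covers : ∀ v → P v → ∃ λ i → y i ≡ v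
  y-covers v p with any? (λ l → x l ≟ v)
  ... | yes (l , eq) = l ↑ˡ j , trans (y-↑ˡ l) eq
  ... | no ¬x = k ↑ʳ index v∈rest , trans (cong [ x , lookupₗ rest ]′ (splitAt-↑ʳ k j (index v∈rest))) (sym (lookup-index v∈rest))
    where v∈rest = ∈-select rest? (p , ¬x)

-- `EdgeTuple` has rank 2; a round adds d for the member z in `Link` and 8 for `AtLeast`.
stageRank : ℕ → ℕ → ℕ
stageRank d zero    = 2
stageRank d (suc g) = 8 + (d + stageRank d g)

-- In `Solves`, 3 quantifiers go to b, c, e, then 2 to v and v′, and 4 are reserved for the colour
-- test; membership of v in the kernel takes the d for the tuple z.
rank : ℕ → ℕ
rank d-1 = 9 + (suc d-1 + stageRank (suc d-1) d-1)

stageRank≡ : ∀ d g → stageRank d g ≡ 2 + g * (8 + d)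
stageRank≡ d zero    = refl
stageRank≡ d (suc g) = trans (cong (λ r → 8 + (d + r)) (stageRank≡ d g)) (arrange d g)
  where
  arrange : ∀ d g → 8 + (d + (2 + g * (8 + d))) ≡ 2 + suc g * (8 + d)
  arrange = solve-∀

-- The rank is d² + 8d + 3, so 21 is generous. The polynomial added in the calculation is the exact
-- difference.
rank≤21d² : ∀ d-1 → rank d-1 ≤ 21 * (suc d-1 * suc d-1)
rank≤21d² n = begin
  9 + (suc n + stageRank (suc n) n)        ≡⟨ cong (λ r → 9 + (suc n + r)) (stageRank≡ (suc n) n) ⟩
  9 + (suc n + (2 + n * (8 + suc n)))      ≤⟨ m≤m+n _ (9 + 32 * n + 20 * (n * n)) ⟩
  9 + (suc n + (2 + n * (8 + suc n))) + (9 + 32 * n + 20 * (n * n)) ≡⟨ arrange n ⟩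
  21 * (suc n * suc n)                     ∎
  where
  open ≤-Reasoning
  arrange : ∀ n → 9 + (suc n + (2 + n * (8 + suc n))) + (9 + 32 * n + 20 * (n * n)) ≡ 21 * (suc n * suc n)
  arrange = solve-∀

module Kernelization (d-1 k : ℕ) where

  d : ℕ
  d = suc d-1

  -- `heavy-hit` needs more than k * bound g linked elements: each of k hitting vertices h accounts
  -- for itself and for fewer than `bound g` elements linked to h ∷ x. The factor k + 1 in place of
  -- k makes monotonicity immediate.
  bound : ℕ → ℕ
  bound zero    = 1
  bound (suc g) = suc (suc k * bound g)

  bound-mono : ∀ {g g′} → g ≤ g′ → bound g ≤ bound g′
  bound-mono {g} {g′} g≤ with m≤n⇒m<n∨m≡n g≤
  ... | inj₂ refl = ≤-refl
  bound-mono {g} {suc g′} g≤ | inj₁ g< = ≤-trans (bound-mono (s≤s⁻¹ g<))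
    (≤-trans (m≤m+n (bound g′) (k * bound g′)) (n≤1+n _))

  open Definability (thresholds (k + bound d))
  open Counting (thresholds (k + bound d))

  enough : ∀ {n} → n ≤ k + bound d → Hashing.threshold n ≤ m
  enough n≤ = ≤-trans (threshold≤ n≤) (n≤1+n _)

  enough-bound : ∀ {g} → g ≤ d → Hashing.threshold (bound g) ≤ m
  enough-bound g≤ = enough (≤-trans (bound-mono g≤) (m≤n+m (bound d) k))

  module _ {r} {F : Pred d} (δ : Def r F) where

    linkD : ∀ {i v} {p : ∀ S → Vec (Elem S) v → Vec (Elem S) i} {y : ∀ S → Vec (Elem S) v → Elem S} →
      DefTuple p → DefTerm y → Def (d + r) (λ S ρ → Link (F S) (p S ρ) (y S ρ))
    linkD p y = ¬D (∈D y p) ∧D ∃*D d (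
      substD δ (takeP d) ∧D (⋀D λ j → ∈D (lookupT (dropP d p) j) (takeP d)) ∧D ∈D (dropT d y) (takeP d))

    link? : ∀ S {i} (x : Vec (Elem S) i) y → Dec (Link (F S) x y)
    link? S x y = dec (linkD (wkP idP) headT) S (y ∷ x)

    module _ {n} (n-enough : Hashing.threshold n ≤ m) where
      open Colours n n-enough using (atLeastD)

      heavyD : ∀ {i v} {p : ∀ S → Vec (Elem S) v → Vec (Elem S) i} → DefTuple p →
        Def (8 + (d + r)) (λ S ρ → Heavy n (F S) (p S ρ))
      heavyD {p = tuple} p = (⋀D λ i → ⋀D λ j → ≡D (lookupT p i) (lookupT p j) ⇒D decD (i ≟ j)) ∧D
                 atLeastD (λ S ρ → Link (F S) (tuple S ρ)) (linkD (wkP p) headT)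

      hasHeavyD : ∀ i → Def (8 + (d + r)) (λ S z → HasHeavy n (F S) i z)
      hasHeavyD i = ⋁ᵥD λ g → heavyD (selectP idP g)

      reduceD : ∀ i → Def (8 + (d + r)) (λ S z → Reduce n (F S) i z)
      reduceD i = (liftD (≤-trans (m≤n+m r d) (m≤n+m (d + r) 8)) δ ∧D ¬D (hasHeavyD i)) ∨D
        (⋁ᵥD λ g → heavyD (selectP idP g) ∧D ⋀D λ l → ∈D (lookupT idP l) (selectP idP g))

  edgeTupleD : Def 2 {d} EdgeTuple
  edgeTupleD = ∃D (E₀D headT ∧D ∀D (εD headT (wkT headT) ⇔D ∈D headT (wkP (wkP idP))))

  -- The d - 1 rounds leading to `Kernel` end with tuples of length 1. The empty tuple is not
  -- treated, because a heavy empty set rules out a solution instead of yielding a smaller set to be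
  -- hit.
  Stage : ℕ → Pred d
  Stage zero    S = EdgeTuple S
  Stage (suc g) S = Reduce (bound (suc g)) (Stage g S) (d-1 ∸ g)

  stageD : ∀ g → g ≤ d → Def (stageRank d g) (Stage g)
  stageD zero    g≤ = edgeTupleD
  stageD (suc g) g≤ = reduceD (stageD g (≤-trans (n≤1+n g) g≤)) (enough-bound g≤) (d-1 ∸ g)

  level : ∀ {g} → suc g ≤ d-1 → d-1 ∸ g ≡ suc (d-1 ∸ suc g)
  level g< = +-∸-assoc 1 g<

  stage-light : ∀ S g → g ≤ d-1 → Light (bound g) (Stage g S) (suc (d-1 ∸ g))
  stage-light S zero    g≤ = light-d (Stage 0 S)
  stage-light S (suc g) g≤ = subst (Light (bound (suc g)) (Stage (suc g) S)) (level g≤)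
    (reduce-light (Stage g S) (d-1 ∸ g) (suc k * bound g))

  -- The size restriction is essential for passing to the next stage, since a larger `H` may hit all
  -- members containing a heavy set without meeting the set. Passing back needs no lightness,
  -- because the added sets are subsets of those removed.
  stage-hits : ∀ S g → g ≤ d-1 → ∀ {H} → length H ≤ k → Hits H (Stage 0 S) ⇔ Hits H (Stage g S)
  stage-hits S zero    g≤ H≤k = mk⇔ (λ h → h) (λ h → h)
  stage-hits S (suc g) g≤ {H} H≤k = mk⇔
    (λ hits → reduce-hits (link? δ S) (stage-light S g g≤′) H≤k (to previous hits))
    (λ hits → from previous (hits-reduce (d-1 ∸ suc g)
      (λ z → subst (λ i → Dec (HasHeavy (bound (suc g)) (Stage g S) i z)) (level g≤)
        (dec (hasHeavyD δ (enough-bound (m≤n⇒m≤1+n g≤)) (d-1 ∸ g)) S z))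
      (subst (λ i → Hits H (Reduce (bound (suc g)) (Stage g S) i)) (level g≤) hits)))
    where
    g≤′ = ≤-trans (n≤1+n g) g≤
    δ = stageD g (m≤n⇒m≤1+n g≤′)
    previous = stage-hits S g g≤′ H≤k

  Kernel : Pred d
  Kernel = Stage d-1

  kernelRank : ℕ
  kernelRank = stageRank d d-1

  kernelD : Def kernelRank Kernel
  kernelD = stageD d-1 (n≤1+n d-1)

  -- Being linked to the empty tuple means lying in some member of the kernel. In this form
  -- `heavy-hit` also bounds the number of kernel vertices.
  KernelVertex : (S : Arithmetical) → Elem S → Set
  KernelVertex S = Link (Kernel S) []

  kernelVertex? : ∀ S v → Dec (KernelVertex S v)
  kernelVertex? S = link? kernelD S []

  colours-enough : (j : Fin (bound d)) → Hashing.threshold (k + toℕ j) ≤ m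
  colours-enough j = enough (+-monoʳ-≤ k (<⇒≤ (toℕ<n j)))

  module Palette (j : Fin (bound d)) = Colours (k + toℕ j) (colours-enough j)

  -- The vertices of a hitting set receive the first k colours, the remaining kernel vertices the
  -- next j.
  Solves : (S : Arithmetical) (j : Fin (bound d)) → Palette.Colouring j → (b c e : Elem S) → Set
  Solves S j κ b c e =
    (∀ (l : Fin k) v v′ → KernelVertex S v → KernelVertex S v′ → Colour l v → Colour l v′ → v ≡ v′) ×
    (∀ z → Kernel S z → ∃ λ i → ∃ λ (l : Fin k) → Colour l (lookup z i))
    where
    Colour : Fin k → Elem S → Set
    Colour l = Palette.HasColour j κ S b c e (l ↑ˡ toℕ j)

  Solvable : Arithmetical → Set
  Solvable S = ¬ AtLeast (bound d) (KernelVertex S) ×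
    Σ (Fin (bound d)) λ j → Σ (Palette.Colouring j) λ κ →
    Σ (Elem S) λ b → Σ (Elem S) λ c → Σ (Elem S) λ e → Solves S j κ b c e

  solvableD : Def (rank d-1) {0} (λ S ρ → Solvable S)
  solvableD = ¬D (liftD (n≤1+n _) (Colours.atLeastD (bound d) (enough-bound ≤-refl) (λ S ρ → KernelVertex S) (linkD kernelD nilP headT))) ∧D
    ⋁D λ j → Palette.⋁κD j λ κ → ∃D (∃D (∃D (
      (⋀D λ l → ∀D (∀D (
        liftD (m≤n+m _ 4) (linkD kernelD nilP (wkT headT)) ⇒D
        liftD (m≤n+m _ 4) (linkD kernelD nilP headT) ⇒D
        Palette.hasColourD j κ (wkT (wkT (wkT (wkT headT)))) (wkT (wkT (wkT headT))) (wkT (wkT headT)) (wkT headT) ⇒D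
        Palette.hasColourD j κ (wkT (wkT (wkT (wkT headT)))) (wkT (wkT (wkT headT))) (wkT (wkT headT)) headT ⇒D
        ≡D (wkT headT) headT))) ∧D
      liftD (≤-trans (≤-reflexive (shift d kernelRank)) (m≤n+m _ 2)) (∀*D d (
        liftD (m≤n+m _ 4) (substD kernelD (takeP d)) ⇒D
        ⋁D λ i → ⋁D λ l → Palette.hasColourD j κ (dropT d (wkT (wkT headT))) (dropT d (wkT headT)) (dropT d headT) (lookupT (takeP d) i))))))
    where
    shift : ∀ d r → d + (4 + r) ≡ 4 + (d + r)
    shift = solve-∀

  isHypergraphD : Def (rank d-1) {0} (λ S ρ → IsHypergraph d S)
  isHypergraphD =
    ∀D (∀D (εD (wkT headT) headT ⇒D (¬D (E₀D (wkT headT)) ∧D E₀D headT))) ∧D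
    ∀D (∀D (E₀D (wkT headT) ⇒D E₀D headT ⇒D
      ∀D (εD headT (wkT (wkT headT)) ⇔D εD headT (wkT headT)) ⇒D ≡D (wkT headT) headT)) ∧D
    ∀D (E₀D headT ⇒D liftD (≤-reflexive (shift d kernelRank))
      (∃*D d (∀D {kernelRank + 7} (εD headT (wkT (dropT d headT)) ⇔D ∈D headT (wkP (takeP d))))))
    where
    shift : ∀ d r → d + suc (r + 7) ≡ 8 + (d + r)
    shift = solve-∀

  -- Any parameters passing the test will do, whether or not they come from a rainbow: uniqueness
  -- lets each of the first k colours select at most one kernel vertex.
  solvable⇒hits : ∀ S → IsHypergraph d S → Solvable S → ∃ λ H → length H ≤ k × HitsEdges S H
  solvable⇒hits S (_ , _ , cover) (_ , j , κ , b , c , e , unique , hit) = H , H≤k , λ f f-edge →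
    let z , f≡z = cover f f-edge
        v , v∈H , v∈z = from (stage-hits S d-1 ≤-refl H≤k) hits-kernel z (f , f-edge , f≡z)
    in  v , v∈H , from (f≡z v) v∈z
    where
    Chosen : Fin k → Elem S → Set
    Chosen l v = KernelVertex S v × Palette.HasColour j κ S b c e (l ↑ˡ toℕ j) v
    chosen? : ∀ l v → Dec (Chosen l v)
    chosen? l v = kernelVertex? S v ×-dec
      dec (Palette.hasColourD j κ {0} headT (wkT headT) (wkT (wkT headT)) (wkT (wkT (wkT headT)))) S (b ∷ c ∷ e ∷ v ∷ [])
    choice : Σ (Fin k → Elem S) λ f → ∀ l v → Chosen l v → f l ≡ v
    choice = partial-choice chosen? λ l v v′ (v-kernel , v-colour) (v′-kernel , v′-colour) →
      unique l v v′ v-kernel v′-kernel v-colour v′-colour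
    H = tabulateₗ (proj₁ choice)
    H≤k : length H ≤ k
    H≤k = ≤-reflexive (length-tabulate (proj₁ choice))
    hits-kernel : Hits H (Kernel S)
    hits-kernel z z-kernel =
      let i , l , colour = hit z z-kernel
      in  lookup z i ,
          subst (_∈ H) (proj₂ choice l (lookup z i) (((λ ()) , z , z-kernel , (λ ()) , i , refl) , colour))
            (∈-tabulate⁺ {f = proj₁ choice} l) ,
          i , refl

  hits⇒solvable : ∀ S (x : Fin k → Elem S) → Injective _≡_ _≡_ x → HitsEdges S (tabulateₗ x) → Solvable S
  hits⇒solvable S x x-injective hits-edges =
    let j , y , y-injective , y≡x , y-covers = enumerate-extending x-injective (kernelVertex? S) few
        κ , b , c , e , exact = Palette.rainbow j S y y-injective
        coloured-x : ∀ l v → KernelVertex S v → Palette.HasColour j κ S b c e (l ↑ˡ toℕ j) v → v ≡ x l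
        coloured-x l v v-kernel v-colour =
          let i , y≡v = y-covers v v-kernel
          in  trans (sym y≡v) (trans (cong y (sym (to (exact (l ↑ˡ toℕ j) i)
                (subst (Palette.HasColour j κ S b c e (l ↑ˡ toℕ j)) (sym y≡v) v-colour)))) (y≡x l))
    in  few , j , κ , b , c , e ,
        (λ l v v′ v-kernel v′-kernel v-colour v′-colour →
          trans (coloured-x l v v-kernel v-colour) (sym (coloured-x l v′ v′-kernel v′-colour))) ,
        (λ z z-kernel →
          let v , v∈H , i , z≡v = hits-kernel z z-kernel
              l , v≡ = ∈-tabulate⁻ v∈H
          in  i , l , subst (Palette.HasColour j κ S b c e (l ↑ˡ toℕ j))
                (trans (y≡x l) (trans (sym v≡) (sym z≡v))) (from (exact (l ↑ˡ toℕ j) (l ↑ˡ toℕ j)) refl))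
    where
    H = tabulateₗ x
    H≤k : length H ≤ k
    H≤k = ≤-reflexive (length-tabulate x)
    hits-kernel : Hits H (Kernel S)
    hits-kernel = to (stage-hits S d-1 ≤-refl H≤k) λ z (f , f-edge , f≡z) →
      let v , v∈H , v∈f = hits-edges f f-edge in v , v∈H , to (f≡z v) v∈f
    -- After the last round the 1-sets are light, so `heavy-hit` applies to the empty tuple: were it
    -- heavy, it would have to contain an element of `H`.
    few : ¬ AtLeast (bound d) (KernelVertex S)
    few many = let _ , _ , i , _ = heavy-hit (link? kernelD S)
                     (subst (λ i → Light (bound d-1) (Kernel S) (suc i)) (n∸n≡0 d-1) (stage-light S d-1 ≤-refl))
                     hits-kernel H≤k [] ((λ ()) , many)
               in  ¬Fin0 i

  -- Solvability yields a hitting set with at most k elements; the second clause allows to enlarge it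
  -- to exactly k.
  Condition : Arithmetical → Set
  Condition S = IsHypergraph d S × AtLeast k (Vertex S) × Solvable S

  conditionD : Def (rank d-1) {0} (λ S ρ → Condition S)
  conditionD = isHypergraphD ∧D
    liftD (≤-trans (m≤n+m 8 (suc d + kernelRank)) (≤-reflexive (shift d kernelRank)))
      (Colours.atLeastD k (enough (m≤m+n k (bound d))) {0} (λ S ρ → Vertex S) (¬D (E₀D headT))) ∧D
    solvableD
    where
    shift : ∀ d r → suc d + r + 8 ≡ 9 + (d + r)
    shift = solve-∀

-- Hypergraphs as structures

elements : ∀ {n} → Subset n → List (Fin n)
elements []            = []
elements (inside ∷ p)  = zero ∷ mapₗ suc (elements p)
elements (outside ∷ p) = mapₗ suc (elements p)

length-elements : ∀ {n} (p : Subset n) → length (elements p) ≡ ∣ p ∣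
length-elements []            = refl
length-elements (inside ∷ p)  = cong suc (trans (length-map suc (elements p)) (length-elements p))
length-elements (outside ∷ p) = trans (length-map suc (elements p)) (length-elements p)

elements-unique : ∀ {n} (p : Subset n) → Unique (elements p)
elements-unique []            = []
elements-unique (inside ∷ p)  =
  All.tabulate (λ x∈ zero≡ → let _ , _ , eq = ∈-map⁻ suc x∈ in contradiction (trans zero≡ eq) λ ()) ∷
  map⁺ suc-injective (elements-unique p)
elements-unique (outside ∷ p) = map⁺ suc-injective (elements-unique p)

∈-elements : ∀ {n} {p : Subset n} {v} → v ∈ₛ p → v ∈ elements p
∈-elements {p = inside ∷ p}  here        = here refl
∈-elements {p = inside ∷ p}  (there v∈p) = there (∈-map⁺ suc (∈-elements v∈p))
∈-elements {p = outside ∷ p} (there v∈p) = ∈-map⁺ suc (∈-elements v∈p)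

elements-∈ : ∀ {n} {p : Subset n} {v} → v ∈ elements p → v ∈ₛ p
elements-∈ {p = inside ∷ p}  (here refl) = here
elements-∈ {p = inside ∷ p}  (there v∈)  with _ , w∈ , refl ← ∈-map⁻ suc v∈ = there (elements-∈ w∈)
elements-∈ {p = outside ∷ p} v∈          with _ , w∈ , refl ← ∈-map⁻ suc v∈ = there (elements-∈ w∈)

∈-enumerated : ∀ {n} (p : Subset n) i → lookupₗ (elements p) i ∈ₛ p
∈-enumerated p i = elements-∈ (∈-lookup i)

enlarge : ∀ {n} (p : Subset n) k → ∣ p ∣ ≤ k → k ≤ n → ∃ λ q → p ⊆ₛ q × ∣ q ∣ ≡ k
enlarge []            zero    p≤k k≤n = [] , (λ ()) , refl
enlarge (inside ∷ p)  (suc k) p≤k k≤n with q , p⊆q , q≡k ← enlarge p k (s≤s⁻¹ p≤k) (s≤s⁻¹ k≤n) =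
  inside ∷ q , (λ { here → here ; (there v∈) → there (p⊆q v∈) }) , cong suc q≡k
enlarge {suc n} (outside ∷ p) k p≤k k≤n with m≤n⇒m<n∨m≡n k≤n
... | inj₁ k<n with q , p⊆q , q≡k ← enlarge p k p≤k (s≤s⁻¹ k<n) =
  outside ∷ q , (λ { (there v∈) → there (p⊆q v∈) }) , q≡k
-- Here k is the size of the whole ground set, so every element, this one included, is added.
... | inj₂ refl with q , p⊆q , q≡n ← enlarge p n (∣p∣≤n p) ≤-refl =
  inside ∷ q , (λ { (there v∈) → there (p⊆q v∈) }) , cong suc q≡n

pad : ∀ {X : Set} n → X → List X → Vec X n
pad zero    a L       = []
pad (suc n) a []      = a ∷ pad n a []
pad (suc n) a (x ∷ L) = x ∷ pad n a L

∈-pad : ∀ {X : Set} {n} {a : X} {L v} → length L ≤ n → v ∈ L → v ∈ᵥ pad n a L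
∈-pad (s≤s L≤n) (here refl) = zero , refl
∈-pad (s≤s L≤n) (there v∈L) with i , eq ← ∈-pad L≤n v∈L = suc i , eq

pad-∈ : ∀ {X : Set} n {a : X} L i → lookup (pad n a L) i ≡ a ⊎ lookup (pad n a L) i ∈ L
pad-∈ (suc n) []      zero    = inj₁ refl
pad-∈ (suc n) []      (suc i) = pad-∈ n [] i
pad-∈ (suc n) (x ∷ L) zero    = inj₂ (here refl)
pad-∈ (suc n) (x ∷ L) (suc i) = map₂ there (pad-∈ n L i)

T-ext : ∀ {a b} → T a ⇔ T b → a ≡ b
T-ext {false} {false} e = refl
T-ext {false} {true}  e = ⊥-elim (from e tt)
T-ext {true}  {false} e = ⊥-elim (to e tt)
T-ext {true}  {true}  e = refl

T⇒∈ₛ : ∀ {n} {p : Subset n} {v} → T (lookup p v) → v ∈ₛ p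
T⇒∈ₛ {p = p} {v} t with lookup p v in eq
... | true = lookup⇒[]= v p eq

∈ₛ⇒T : ∀ {n} {p : Subset n} {v} → v ∈ₛ p → T (lookup p v)
∈ₛ⇒T v∈p = subst T (sym ([]=⇒lookup v∈p)) tt

isInj₂ : ∀ {X Y : Set} → X ⊎ Y → Bool
isInj₂ (inj₁ _) = false
isInj₂ (inj₂ _) = true

incidence : ∀ G → Fin (nv G) ⊎ Fin (ne G) → Fin (nv G) ⊎ Fin (ne G) → Bool
incidence G (inj₁ v) (inj₂ e) = lookup (edge G e) v
incidence G (inj₁ v) (inj₁ _) = false
incidence G (inj₂ _) _        = false

GE₀-splitAt : ∀ G x → GE₀ G x ≡ isInj₂ (splitAt (nv G) x)
GE₀-splitAt G x with splitAt (nv G) x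
... | inj₁ _ = refl
... | inj₂ _ = refl

Gε-splitAt : ∀ G x y → Gε G x y ≡ incidence G (splitAt (nv G) x) (splitAt (nv G) y)
Gε-splitAt G x y with splitAt (nv G) x | splitAt (nv G) y
... | inj₁ v | inj₂ e = refl
... | inj₁ v | inj₁ _ = refl
... | inj₂ _ | inj₁ _ = refl
... | inj₂ _ | inj₂ _ = refl

-- From hypergraphs to first-order conditions

module FromHypergraph {d-1 k : ℕ} (S : Arithmetical) (G : Hypergraph) (R : ReductIso (structure S) G)
    (edges≤ : EdgesAtMost (suc d-1) G) where
  open ReductIso R

  private
    A = structure S

    sort : Elem S → Fin (nv G) ⊎ Fin (ne G)
    sort x = splitAt (nv G) (Inverse.to σ x)

    object : Fin (nv G) ⊎ Fin (ne G) → Elem S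
    object s = Inverse.from σ (join (nv G) (ne G) s)

    sort-object : ∀ s → sort (object s) ≡ s
    sort-object s = trans (cong (splitAt (nv G)) (Inverse.strictlyInverseˡ σ _)) (splitAt-join (nv G) (ne G) s)

    object-sort : ∀ x → object (sort x) ≡ x
    object-sort x = trans (cong (Inverse.from σ) (join-splitAt (nv G) (ne G) (Inverse.to σ x))) (Inverse.strictlyInverseʳ σ x)

    E₀-object : ∀ s → E₀ A (object s) ≡ isInj₂ s
    E₀-object s = trans (presE₀ _) (trans (GE₀-splitAt G _) (cong isInj₂ (sort-object s)))

    ε-object : ∀ s t → ε A (object s) (object t) ≡ incidence G s t
    ε-object s t = trans (presε _ _) (trans (Gε-splitAt G _ _) (cong₂ (incidence G) (sort-object s) (sort-object t)))

    by-sort : (P : Elem S → Set) → (∀ s → P (object s)) → ∀ x → P x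
    by-sort P p x = subst P (object-sort x) (p (sort x))

    typed : ∀ s t → T (incidence G s t) → ¬ T (isInj₂ s) × T (isInj₂ t)
    typed (inj₁ v) (inj₂ e) _ = (λ ()) , tt

    incident⇔ : ∀ v e → Incident S (object (inj₁ v)) (object (inj₂ e)) ⇔ (v ∈ₛ edge G e)
    incident⇔ v e = mk⇔ (λ i → T⇒∈ₛ (subst T (ε-object (inj₁ v) (inj₂ e)) i))
                        (λ v∈ → subst T (sym (ε-object (inj₁ v) (inj₂ e))) (∈ₛ⇒T v∈))

    is-edge : ∀ e → Edge S (object (inj₂ e))
    is-edge e = subst T (sym (E₀-object (inj₂ e))) tt

    is-vertex : ∀ v → Vertex S (object (inj₁ v))
    is-vertex v e = subst T (E₀-object (inj₁ v)) e

    by-edge : (P : Elem S → Set) → (∀ e → P (object (inj₂ e))) → ∀ x → Edge S x → P x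
    by-edge P p = by-sort (λ x → Edge S x → P x) λ
      { (inj₁ v) x-edge → contradiction x-edge (is-vertex v) ; (inj₂ e) _ → p e }

    vertex-injective : ∀ {v w} → object (inj₁ v) ≡ object (inj₁ w) → v ≡ w
    vertex-injective {v} {w} eq = inj₁-injective (trans (sym (sort-object (inj₁ v))) (trans (cong sort eq) (sort-object (inj₁ w))))

    cover : ∀ e → Σ (Vec (Elem S) (suc d-1)) λ z → ∀ v → Incident S v (object (inj₂ e)) ⇔ (v ∈ᵥ z)
    cover e = z , by-sort _ λ
      { (inj₁ v) → mk⇔
          (λ i → ∈-pad length≤ (∈-map⁺ vertex (∈-elements (to (incident⇔ v e) i))))
          (λ { (i , eq) → subst (λ x → Incident S x (object (inj₂ e))) eq (members i) })
      ; (inj₂ f) → mk⇔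
          (λ i → ⊥-elim (subst T (ε-object (inj₂ f) (inj₂ e)) i))
          (λ { (i , eq) → subst (λ x → Incident S x (object (inj₂ e))) eq (members i) }) }
      where
      vertex : Fin (nv G) → Elem S
      vertex v = object (inj₁ v)
      L = mapₗ vertex (elements (edge G e))
      -- The padding must itself belong to the edge, since z has to list exactly its elements;
      -- nonemptiness provides it.
      a = vertex (proj₁ (nonempty G e))
      z = pad (suc d-1) a L
      length≤ : length L ≤ suc d-1
      length≤ = ≤-trans (≤-reflexive (trans (length-map vertex (elements (edge G e))) (length-elements (edge G e)))) (edges≤ e)
      members : ∀ i → Incident S (lookup z i) (object (inj₂ e))
      members i with pad-∈ (suc d-1) {a} L i
      ... | inj₁ eq = subst (λ x → Incident S x (object (inj₂ e))) (sym eq) (from (incident⇔ _ e) (proj₂ (nonempty G e)))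
      ... | inj₂ ∈L = let w , w∈ , eq = ∈-map⁻ vertex ∈L
                      in  subst (λ x → Incident S x (object (inj₂ e))) (sym eq) (from (incident⇔ w e) (elements-∈ w∈))

  isHypergraph : IsHypergraph (suc d-1) S
  isHypergraph =
    (by-sort _ λ s → by-sort _ λ t i →
      let s-vertex , t-edge = typed s t (subst T (ε-object s t) i)
      in  (λ s-edge → s-vertex (subst T (E₀-object s) s-edge)) , subst T (sym (E₀-object t)) t-edge) ,
    (λ x y x-edge y-edge → by-edge (λ x → (∀ v → Incident S v x ⇔ Incident S v y) → x ≡ y)
      (λ e → by-edge (λ y → (∀ v → Incident S v (object (inj₂ e)) ⇔ Incident S v y) → object (inj₂ e) ≡ y)
        (λ f same → cong (λ e → object (inj₂ e)) (distinct G (same-edge e f same))) y y-edge) x x-edge) ,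
    by-edge _ cover
    where
    same-edge : ∀ e f → (∀ v → Incident S v (object (inj₂ e)) ⇔ Incident S v (object (inj₂ f))) → edge G e ≡ edge G f
    same-edge e f same = begin
      edge G e                      ≡⟨ tabulate∘lookup (edge G e) ⟨
      tabulate (lookup (edge G e))  ≡⟨ tabulate-cong (λ v → T-ext (mk⇔
        (λ t → ∈ₛ⇒T (to (incident⇔ v f) (to (same (object (inj₁ v))) (from (incident⇔ v e) (T⇒∈ₛ t)))))
        (λ t → ∈ₛ⇒T (to (incident⇔ v e) (from (same (object (inj₁ v))) (from (incident⇔ v f) (T⇒∈ₛ t))))))) ⟩
      tabulate (lookup (edge G f))  ≡⟨ tabulate∘lookup (edge G f) ⟩
      edge G f                      ∎
      where open ≡-Reasoning

  hitting : HasHittingSetOfSize G k →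
    Σ (Fin k → Elem S) λ x → Injective _≡_ _≡_ x × (∀ i → Vertex S (x i)) × HitsEdges S (tabulateₗ x)
  hitting (H , hits , refl) = x , x-injective , (λ i → is-vertex _) , by-edge _ λ e →
    let v , v∈H , v∈e = hits e
        i = cast (length-elements H) (index (∈-elements v∈H))
    in  object (inj₁ v) ,
        subst (_∈ tabulateₗ x) (cong (λ v → object (inj₁ v))
          (trans (cong (lookupₗ (elements H)) (cast-involutive (sym (length-elements H)) (length-elements H) (index (∈-elements v∈H))))
            (sym (lookup-index (∈-elements v∈H)))))
          (∈-tabulate⁺ {f = x} i) ,
        from (incident⇔ v e) v∈e
    where
    x : Fin ∣ H ∣ → Elem S
    x i = object (inj₁ (lookupₗ (elements H) (cast (sym (length-elements H)) i)))
    x-injective : Injective _≡_ _≡_ x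
    x-injective {i} {j} eq = toℕ-injective (trans (sym (toℕ-cast _ i)) (trans
      (cong toℕ (unique⇒lookup-injective (elements-unique H) (vertex-injective eq))) (toℕ-cast _ j)))

-- From the conditions back to a hypergraph

record Partition {N : ℕ} (P : Fin N → Bool) : Set where
  field
    {a b} : ℕ
    sorting : Fin N ↔ (Fin a ⊎ Fin b)
    sorted  : ∀ x → P x ≡ isInj₂ (Inverse.to sorting x)

partition : ∀ {N} (P : Fin N → Bool) → Partition P
partition {zero} P = record
  { a = 0 ; b = 0
  ; sorting = mk↔ₛ′ (λ ()) (λ { (inj₁ ()) ; (inj₂ ()) }) (λ { (inj₁ ()) ; (inj₂ ()) }) (λ ())
  ; sorted  = λ () }
partition {suc N} P with P zero in P-zero | partition (λ x → P (suc x))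
... | false | record { a = a ; b = b ; sorting = s ; sorted = p } = record
  { sorting = mk↔ₛ′ f g f∘g g∘f ; sorted = λ { zero → P-zero ; (suc x) → trans (p x) (isInj₂-map₁ (Inverse.to s x)) } }
  where
  f : Fin (suc N) → Fin (suc a) ⊎ Fin b
  f zero    = inj₁ zero
  f (suc x) = map₁ suc (Inverse.to s x)
  g : Fin (suc a) ⊎ Fin b → Fin (suc N)
  g (inj₁ zero)    = zero
  g (inj₁ (suc v)) = suc (Inverse.from s (inj₁ v))
  g (inj₂ e)       = suc (Inverse.from s (inj₂ e))
  f∘g : ∀ y → f (g y) ≡ y
  f∘g (inj₁ zero)    = refl
  f∘g (inj₁ (suc v)) = cong (map₁ suc) (Inverse.strictlyInverseˡ s (inj₁ v))
  f∘g (inj₂ e)       = cong (map₁ suc) (Inverse.strictlyInverseˡ s (inj₂ e))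
  g-map₁ : ∀ y → g (map₁ suc y) ≡ suc (Inverse.from s y)
  g-map₁ (inj₁ _) = refl
  g-map₁ (inj₂ _) = refl
  g∘f : ∀ x → g (f x) ≡ x
  g∘f zero    = refl
  g∘f (suc x) = trans (g-map₁ (Inverse.to s x)) (cong suc (Inverse.strictlyInverseʳ s x))
  isInj₂-map₁ : ∀ (y : Fin a ⊎ Fin b) → isInj₂ y ≡ isInj₂ (map₁ suc y)
  isInj₂-map₁ (inj₁ _) = refl
  isInj₂-map₁ (inj₂ _) = refl
... | true | record { a = a ; b = b ; sorting = s ; sorted = p } = record
  { sorting = mk↔ₛ′ f g f∘g g∘f ; sorted = λ { zero → P-zero ; (suc x) → trans (p x) (isInj₂-map₂ (Inverse.to s x)) } }
  where
  f : Fin (suc N) → Fin a ⊎ Fin (suc b)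
  f zero    = inj₂ zero
  f (suc x) = map₂ suc (Inverse.to s x)
  g : Fin a ⊎ Fin (suc b) → Fin (suc N)
  g (inj₁ v)       = suc (Inverse.from s (inj₁ v))
  g (inj₂ zero)    = zero
  g (inj₂ (suc e)) = suc (Inverse.from s (inj₂ e))
  f∘g : ∀ y → f (g y) ≡ y
  f∘g (inj₁ v)       = cong (map₂ suc) (Inverse.strictlyInverseˡ s (inj₁ v))
  f∘g (inj₂ zero)    = refl
  f∘g (inj₂ (suc e)) = cong (map₂ suc) (Inverse.strictlyInverseˡ s (inj₂ e))
  g-map₂ : ∀ y → g (map₂ suc y) ≡ suc (Inverse.from s y)
  g-map₂ (inj₁ _) = refl
  g-map₂ (inj₂ _) = refl
  g∘f : ∀ x → g (f x) ≡ x
  g∘f zero    = refl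
  g∘f (suc x) = trans (g-map₂ (Inverse.to s x)) (cong suc (Inverse.strictlyInverseʳ s x))
  isInj₂-map₂ : ∀ (y : Fin a ⊎ Fin b) → isInj₂ y ≡ isInj₂ (map₂ suc y)
  isInj₂-map₂ (inj₁ _) = refl
  isInj₂-map₂ (inj₂ _) = refl

toHypergraph : ∀ {d-1 k} S → IsHypergraph (suc d-1) S → AtLeast k (Vertex S) →
  (∃ λ H → length H ≤ k × HitsEdges S H) → pHittingSet (suc d-1) (structure S) k
toHypergraph {d-1} {k} S (typed , extensional , cover) (y , y-injective , y-vertex) (H , H≤k , hits) =
  G , record { σ = σ ; presE₀ = presE₀ ; presε = presε } , edges≤ , H′ , hits′ , H′≡k
  where
  A = structure S
  open Partition (partition (E₀ A))

  sort : Elem S → Fin a ⊎ Fin b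
  sort = Inverse.to sorting
  vertex : Fin a → Elem S
  vertex v = Inverse.from sorting (inj₁ v)
  edge′ : Fin b → Elem S
  edge′ e = Inverse.from sorting (inj₂ e)

  vertex-injective : Injective _≡_ _≡_ vertex
  vertex-injective eq = inj₁-injective
    (trans (sym (Inverse.strictlyInverseˡ sorting _)) (trans (cong sort eq) (Inverse.strictlyInverseˡ sorting _)))
  edge-injective : Injective _≡_ _≡_ edge′
  edge-injective eq = inj₂-injective
    (trans (sym (Inverse.strictlyInverseˡ sorting _)) (trans (cong sort eq) (Inverse.strictlyInverseˡ sorting _)))

  is-edge : ∀ e → Edge S (edge′ e)
  is-edge e = subst T (sym (trans (sorted (edge′ e)) (cong isInj₂ (Inverse.strictlyInverseˡ sorting (inj₂ e))))) tt

  find-vertex : ∀ x → Vertex S x → ∃ λ v → vertex v ≡ x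
  find-vertex x x-vertex with sort x in eq
  ... | inj₁ v = v , trans (cong (Inverse.from sorting) (sym eq)) (Inverse.strictlyInverseʳ sorting x)
  ... | inj₂ e = contradiction (subst T (sym (trans (sorted x) (cong isInj₂ eq))) tt) x-vertex

  members : Fin b → Subset a
  members e = tabulate λ v → ε A (vertex v) (edge′ e)

  member⇔ : ∀ v e → Incident S (vertex v) (edge′ e) ⇔ (v ∈ₛ members e)
  member⇔ v e = mk⇔
    (λ i → T⇒∈ₛ (subst T (sym (lookup∘tabulate _ v)) i))
    (λ v∈ → subst T (lookup∘tabulate _ v) (∈ₛ⇒T v∈))

  incident-vertex : ∀ {x e} → Incident S x (edge′ e) → ∃ λ v → vertex v ≡ x × v ∈ₛ members e
  incident-vertex {x} {e} i with v , refl ← find-vertex x (proj₁ (typed x (edge′ e) i)) =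
    v , refl , to (member⇔ v e) i

  G : Hypergraph
  G = record
    { nv = a ; ne = b ; edge = members
    ; nonempty = λ e → let z , z≡ = cover (edge′ e) (is-edge e)
                           v , _ , v∈ = incident-vertex (from (z≡ (lookup z zero)) (zero , refl))
                       in  v , v∈
    ; distinct = λ {e} {f} eq → edge-injective (extensional (edge′ e) (edge′ f) (is-edge e) (is-edge f) λ x → mk⇔
        (included eq) (included (sym eq))) }
    where
    included : ∀ {e f x} → members e ≡ members f → Incident S x (edge′ e) → Incident S x (edge′ f)
    included {e} {f} eq i with v , refl , v∈ ← incident-vertex i = from (member⇔ v f) (subst (v ∈ₛ_) eq v∈)

  σ : Fin _ ↔ Fin (a + b)
  σ = ↔-sym +↔⊎ ↔-∘ sorting

  presE₀ : ∀ x → E₀ A x ≡ GE₀ G (Inverse.to σ x)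
  presE₀ x = trans (sorted x) (trans (cong isInj₂ (sym (splitAt-join a b (sort x)))) (sym (GE₀-splitAt G _)))

  ε-sorted : ∀ s t → ε A (Inverse.from sorting s) (Inverse.from sorting t) ≡ incidence G s t
  ε-sorted (inj₁ v) (inj₂ e) = sym (lookup∘tabulate _ v)
  ε-sorted (inj₁ v) (inj₁ w) = T-ext (mk⇔ (λ i → contradiction (proj₂ (typed _ _ i)) not-edge) λ ())
    where
    not-edge : Vertex S (vertex w)
    not-edge t = subst T (trans (sorted (vertex w)) (cong isInj₂ (Inverse.strictlyInverseˡ sorting (inj₁ w)))) t
  ε-sorted (inj₂ e) t = T-ext (mk⇔ (λ i → contradiction (is-edge e) (proj₁ (typed _ _ i))) λ ())

  presε : ∀ x y → ε A x y ≡ Gε G (Inverse.to σ x) (Inverse.to σ y)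
  presε x y = begin
    ε A x y                                                                       ≡⟨ cong₂ (ε A) (Inverse.strictlyInverseʳ sorting x) (Inverse.strictlyInverseʳ sorting y) ⟨
    ε A (Inverse.from sorting (sort x)) (Inverse.from sorting (sort y))           ≡⟨ ε-sorted (sort x) (sort y) ⟩
    incidence G (sort x) (sort y)                                                 ≡⟨ cong₂ (incidence G) (splitAt-join a b (sort x)) (splitAt-join a b (sort y)) ⟨
    incidence G (splitAt a (join a b (sort x))) (splitAt a (join a b (sort y)))   ≡⟨ Gε-splitAt G _ _ ⟨
    Gε G (Inverse.to σ x) (Inverse.to σ y)                                        ∎
    where open ≡-Reasoning

  edges≤ : EdgesAtMost (suc d-1) G
  edges≤ e = let z , z≡ = cover (edge′ e) (is-edge e)
                 in-z : ∀ i → vertex (lookupₗ (elements (members e)) i) ∈ᵥ z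
                 in-z i = to (z≡ _) (from (member⇔ _ e) (∈-enumerated (members e) i))
             in  subst (_≤ suc d-1) (length-elements (members e))
                   (injective⇒≤ {f = λ i → proj₁ (in-z i)} λ {i} {j} eq →
                     unique⇒lookup-injective (elements-unique (members e)) (vertex-injective
                       (trans (sym (proj₂ (in-z i))) (trans (cong (lookup z) eq) (proj₂ (in-z j))))))

  in-H? : ∀ v → Dec (vertex v ∈ H)
  in-H? v = Any.any? (vertex v ≟_) H

  -- `H` may contain default values that are edges. Restricting it to vertices preserves hitting, as
  -- only vertices are incident with an edge.
  H₀ : Subset a
  H₀ = tabulate λ v → ⌊ in-H? v ⌋

  H₀-∈ : ∀ {v} → v ∈ₛ H₀ → vertex v ∈ H
  H₀-∈ {v} v∈ = toWitness (subst T (lookup∘tabulate _ v) (∈ₛ⇒T v∈))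

  H₀≤k : ∣ H₀ ∣ ≤ k
  H₀≤k = ≤-trans (subst (_≤ length H) (length-elements H₀)
    (injective-into-list {x = λ i → vertex (lookupₗ (elements H₀) i)}
      (λ eq → unique⇒lookup-injective (elements-unique H₀) (vertex-injective eq))
      (λ i → H₀-∈ (∈-enumerated H₀ i)))) H≤k

  k≤a : k ≤ a
  k≤a = injective⇒≤ {f = λ i → proj₁ (find-vertex (y i) (y-vertex i))} λ {i} {j} eq → y-injective
    (trans (sym (proj₂ (find-vertex (y i) (y-vertex i)))) (trans (cong vertex eq) (proj₂ (find-vertex (y j) (y-vertex j)))))

  enlarged = enlarge H₀ k H₀≤k k≤a
  H′ = proj₁ enlarged
  H′≡k = proj₂ (proj₂ enlarged)

  hits′ : HittingSet G H′
  hits′ e with x , x∈H , i ← hits (edge′ e) (is-edge e)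
    with v , refl , v∈e ← incident-vertex i =
    v , proj₁ (proj₂ enlarged) (T⇒∈ₛ (subst T (sym (lookup∘tabulate _ v)) (fromWitness x∈H))) , v∈e

-- Correctness of the sentence and its rank

pHittingSet⇔condition : ∀ d-1 k S →
  pHittingSet (suc d-1) (structure S) k ⇔ Kernelization.Condition d-1 k S
pHittingSet⇔condition d-1 k S = mk⇔
  (λ (G , R , edges≤ , hitting-set) →
    let open FromHypergraph S G R edges≤
        x , x-injective , x-vertex , hits = hitting hitting-set
    in  isHypergraph , (x , x-injective , x-vertex) , hits⇒solvable S x x-injective hits)
  (λ (hypergraph , enough-vertices , solvable) →
    toHypergraph S hypergraph enough-vertices (solvable⇒hits S hypergraph solvable))
  where open Kernelization d-1 k

pHittingSet-definable : ∀ d-1 → SlicewiseDefinable (rank d-1) (pHittingSet (suc d-1))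
pHittingSet-definable d-1 =
  -- Enough constants for every palette that occurs, none having more than k + bound d colours.
  (λ k → suc (thresholds (k + Kernelization.bound d-1 k (suc d-1)))) ,
  (λ k → formula k) ,
  (λ k → Definability.rank≤ (definition k)) ,
  λ A w k → ⇔-trans (pHittingSet⇔condition d-1 k (arithmetical A w)) (⇔-sym (⇔-trans
    -- `noVars` and `lookup []` are two forms of the empty assignment.
    (sat-ext A _ (λ ()) (formula k))
    (Definability.correct (definition k) (arithmetical A w) [])))
  where
  definition = λ k → Kernelization.conditionD d-1 k
  formula = λ k → Definability.formula (definition k)

theorem3p1 : Σ ℕ λ c → (d : ℕ) → 1 ≤ d →
    Σ ℕ λ q → q ≤ c * (d * d) × SlicewiseDefinable q (pHittingSet d)
theorem3p1 = 21 , λ { (suc d-1) _ → rank d-1 , rank≤21d² d-1 , pHittingSet-definable d-1 }
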